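{- Let $q=p^h$ with $p$ prime. Let $B$ be a minimal blocking set with respect to lines in $PG(2,q)$ with $|B|=q+k$, where $k<(q+3)/2$. Suppose there is a line $L$ with $|L\cap B|=k$. Then $v_B-v_L$ is a codeword of $C(PG(2,q))^\perp$ of weight $2q+1-k$, where $v_B,v_L$ are the incidence vectors of $B$ and $L$.
   Context: $C(PG(2,q))$ is the $\mathbb{F}_p$-span of the incidence vectors of the lines of $PG(2,q)$, with coordinates indexed by points. $C^\perp$ is its dual with respect to the standard scalar product over $\mathbb{F}_p$. A blocking set with respect to lines is a point set meeting every line. It is minimal if no proper subset is a blocking set. -}

module Defs where

open import Algebra.Bundles using (CommutativeRing)
open import Algebra.Structures using (IsCommutativeRing)
import Algebra.Properties.Monoid.Sum as MonoidSum
open import Data.Bool.Base using (if_then_else_; not)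
open import Data.Fin.Base using (Fin)
open import Data.Fin.Properties using (_≟_; +↔⊎; *↔×; 1↔⊤)
open import Data.Fin.Subset using (Subset; Nonempty; _∩_; _⊂_; ∣_∣)
import Data.Nat.Base as ℕ
open import Data.Nat.Base using (ℕ)
open import Data.Product.Base using (Σ; ∃; _×_; _,_; proj₁; proj₂)
open import Data.Product.Function.NonDependent.Propositional using (_×-↔_)
open import Data.Sum.Base using (_⊎_; inj₁; inj₂)
open import Data.Sum.Function.Propositional using (_⊎-↔_)
open import Data.Unit.Base using (⊤; tt)
open import Data.Vec.Base using (Vec; []; _∷_; map; replicate; tabulate; lookup)
open import Data.Vec.Functional using (Vector)
open import Function.Base using (_∘_)
open import Function.Bundles using (Inverse; _↔_; module Inverse)
open import Function.Construct.Composition using (_↔-∘_) renaming (inverse to inverse-∘)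
open import Function.Construct.Symmetry using (↔-sym)
open import Function.Properties.Inverse using (↔⇒↣)
open import Level using (0ℓ)
open import Relation.Binary.Bundles using (Setoid)
open import Relation.Binary.Definitions using (DecidableEquality)
open import Relation.Binary.PropositionalEquality
open import Relation.Nullary.Decidable using (yes; no; does; via-injection)
open import Relation.Nullary.Negation using (¬_; contradiction)

record FiniteField (q : ℕ) : Set₁ where
  infixl 7 _*_
  infixl 6 _+_
  infix  8 -_
  field
    Carrier           : Set
    _+_ _*_           : Carrier → Carrier → Carrier
    -_                : Carrier → Carrier
    0# 1#             : Carrier
    isCommutativeRing : IsCommutativeRing _≡_ _+_ _*_ -_ 0# 1#
    0≢1               : 0# ≢ 1#
    inverse           : ∀ x → x ≢ 0# → ∃ λ y → x * y ≡ 1#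
    enumeration       : Carrier ↔ Fin q

  commutativeRing : CommutativeRing 0ℓ 0ℓ
  commutativeRing = record { isCommutativeRing = isCommutativeRing }

  open CommutativeRing commutativeRing public
    using (_-_; +-monoid; +-assoc; +-comm; +-identityˡ; +-identityʳ;
           *-assoc; *-comm; *-identityˡ; *-identityʳ; zeroˡ; zeroʳ)

  open MonoidSum +-monoid public using (sum)

  infix 4 _≟ᶠ_
  _≟ᶠ_ : DecidableEquality Carrier
  _≟ᶠ_ = via-injection (↔⇒↣ enumeration) _≟_

-- PG(2,q) in homogeneous coordinates over a field with q elements.
module ProjectivePlane {q : ℕ} (F : FiniteField q) where
  open FiniteField F

  NonzeroVector : Set
  NonzeroVector = Σ (Vec Carrier 3) λ v → v ≢ replicate 3 0#

  infix 4 _∼_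
  _∼_ : NonzeroVector → NonzeroVector → Set
  (u , _) ∼ (v , _) = ∃ λ c → c ≢ 0# × u ≡ map (c *_) v

  private
    vec≡ : ∀ {x y z x′ y′ z′ : Carrier} → x ≡ x′ → y ≡ y′ → z ≡ z′ →
           _≡_ {A = Vec Carrier 3} (x ∷ y ∷ z ∷ []) (x′ ∷ y′ ∷ z′ ∷ [])
    vec≡ refl refl refl = refl

    scale-1 : (v : Vec Carrier 3) → v ≡ map (1# *_) v
    scale-1 (x ∷ y ∷ z ∷ []) =
      vec≡ (sym (*-identityˡ x)) (sym (*-identityˡ y)) (sym (*-identityˡ z))

    scale-* : ∀ c d (v : Vec Carrier 3) → map (c *_) (map (d *_) v) ≡ map ((c * d) *_) v
    scale-* c d (x ∷ y ∷ z ∷ []) =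
      vec≡ (sym (*-assoc c d x)) (sym (*-assoc c d y)) (sym (*-assoc c d z))

    unit : ∀ {x y} → x * y ≡ 1# → y ≢ 0#
    unit {x} xy≡1 refl = 0≢1 (trans (sym (zeroʳ x)) xy≡1)

    *-≢0 : ∀ {c d} → c ≢ 0# → d ≢ 0# → c * d ≢ 0#
    *-≢0 {c} {d} c≢0 d≢0 cd≡0 with c⁻¹ , cc⁻¹≡1 ← inverse c c≢0 = d≢0 (begin
      d               ≡⟨ *-identityˡ d ⟨
      1# * d          ≡⟨ cong (_* d) (trans (*-comm c⁻¹ c) cc⁻¹≡1) ⟨
      c⁻¹ * c * d     ≡⟨ *-assoc c⁻¹ c d ⟩
      c⁻¹ * (c * d)   ≡⟨ cong (c⁻¹ *_) cd≡0 ⟩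
      c⁻¹ * 0#        ≡⟨ zeroʳ c⁻¹ ⟩
      0#              ∎)
      where open ≡-Reasoning

    ∼-refl : ∀ {u} → u ∼ u
    ∼-refl {u , _} = 1# , 0≢1 ∘ sym , scale-1 u

    ∼-sym : ∀ {u v} → u ∼ v → v ∼ u
    ∼-sym {_} {v , _} (c , c≢0 , refl) with c⁻¹ , cc⁻¹≡1 ← inverse c c≢0 =
      c⁻¹ , unit cc⁻¹≡1 ,
      trans (scale-1 v)
        (trans (cong (λ a → map (a *_) v) (sym (trans (*-comm c⁻¹ c) cc⁻¹≡1)))
          (sym (scale-* c⁻¹ c v)))

    ∼-trans : ∀ {u v w} → u ∼ v → v ∼ w → u ∼ w
    ∼-trans {w = w , _} (c , c≢0 , refl) (d , d≢0 , refl) =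
      c * d , *-≢0 c≢0 d≢0 , scale-* c d w

  pointSetoid : Setoid 0ℓ 0ℓ
  pointSetoid = record
    { Carrier       = NonzeroVector
    ; _≈_           = _∼_
    ; isEquivalence = record
      { refl  = λ {u} → ∼-refl {u}
      ; sym   = λ {u} {v} → ∼-sym {u} {v}
      ; trans = λ {u} {v} {w} → ∼-trans {u} {v} {w}
      }
    }

  pointCount : ℕ
  pointCount = q ℕ.* q ℕ.+ (q ℕ.+ 1)

  -- Each point has exactly one representative of the form
  -- (1, a, b), (0, 1, a) or (0, 0, 1).
  private
    Normal : Set
    Normal = (Carrier × Carrier) ⊎ (Carrier ⊎ ⊤)

    normal↔Fin : Normal ↔ Fin pointCount
    normal↔Fin = ↔-sym
      ((↔-sym enumeration ×-↔ ↔-sym enumeration ⊎-↔ (↔-sym enumeration ⊎-↔ 1↔⊤))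
        ↔-∘ ((*↔× ⊎-↔ +↔⊎) ↔-∘ +↔⊎))

    1≢0 : 1# ≢ 0#
    1≢0 = 0≢1 ∘ sym

    representative : Normal → NonzeroVector
    representative (inj₁ (a , b))   = (1# ∷ a ∷ b ∷ []) , λ { refl → 0≢1 refl }
    representative (inj₂ (inj₁ a))  = (0# ∷ 1# ∷ a ∷ []) , λ { refl → 0≢1 refl }
    representative (inj₂ (inj₂ tt)) = (0# ∷ 0# ∷ 1# ∷ []) , λ { refl → 0≢1 refl }

    cancel : ∀ {x x⁻¹} → x * x⁻¹ ≡ 1# → ∀ y → y ≡ x * (x⁻¹ * y)
    cancel {x} {x⁻¹} xx⁻¹≡1 y =
      trans (sym (*-identityˡ y)) (trans (cong (_* y) (sym xx⁻¹≡1)) (*-assoc x x⁻¹ y))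

    normalise : ∀ v → Σ Normal λ n → v ∼ representative n
    normalise ((x ∷ y ∷ z ∷ []) , v≢0) with x ≟ᶠ 0#
    ... | no x≢0 with x⁻¹ , xx⁻¹≡1 ← inverse x x≢0 =
      inj₁ (x⁻¹ * y , x⁻¹ * z) , x , x≢0 ,
      vec≡ (sym (*-identityʳ x)) (cancel xx⁻¹≡1 y) (cancel xx⁻¹≡1 z)
    ... | yes refl with y ≟ᶠ 0#
    ...   | no y≢0 with y⁻¹ , yy⁻¹≡1 ← inverse y y≢0 =
      inj₂ (inj₁ (y⁻¹ * z)) , y , y≢0 ,
      vec≡ (sym (zeroʳ y)) (sym (*-identityʳ y)) (cancel yy⁻¹≡1 z)
    ...   | yes refl with z ≟ᶠ 0#
    ...     | no z≢0 =
      inj₂ (inj₂ tt) , z , z≢0 ,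
      vec≡ (sym (zeroʳ z)) (sym (zeroʳ z)) (sym (*-identityʳ z))
    ...     | yes refl = contradiction refl v≢0

    coords : ∀ {x y z x′ y′ z′ : Carrier} →
             _≡_ {A = Vec Carrier 3} (x ∷ y ∷ z ∷ []) (x′ ∷ y′ ∷ z′ ∷ []) →
             x ≡ x′ × y ≡ y′ × z ≡ z′
    coords refl = refl , refl , refl

    one : ∀ {c} → 1# ≡ c * 1# → c ≡ 1#
    one {c} e = sym (trans e (*-identityʳ c))

    unscale : ∀ {c} → c ≡ 1# → ∀ {a a′} → a ≡ c * a′ → a ≡ a′
    unscale refl {a′ = a′} e = trans e (*-identityˡ a′)

    1≢c0 : ∀ {c} {A : Set} → 1# ≡ c * 0# → A
    1≢c0 {c} e = contradiction (trans e (zeroʳ c)) 1≢0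

    0≢c1 : ∀ {c} {A : Set} → c ≢ 0# → 0# ≡ c * 1# → A
    0≢c1 {c} c≢0 e = contradiction (trans (sym (*-identityʳ c)) (sym e)) c≢0

    injective : ∀ m n → representative m ∼ representative n → m ≡ n
    injective (inj₁ _) (inj₁ _) (c , _ , e) with e₁ , e₂ , e₃ ← coords e =
      cong₂ (λ a b → inj₁ (a , b)) (unscale (one e₁) e₂) (unscale (one e₁) e₃)
    injective (inj₁ _) (inj₂ (inj₁ _)) (c , _ , e) = 1≢c0 (proj₁ (coords e))
    injective (inj₁ _) (inj₂ (inj₂ _)) (c , _ , e) = 1≢c0 (proj₁ (coords e))
    injective (inj₂ (inj₁ _)) (inj₁ _) (c , c≢0 , e) = 0≢c1 c≢0 (proj₁ (coords e))
    injective (inj₂ (inj₁ _)) (inj₂ (inj₁ _)) (c , _ , e) with _ , e₂ , e₃ ← coords e =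
      cong (inj₂ ∘ inj₁) (unscale (one e₂) e₃)
    injective (inj₂ (inj₁ _)) (inj₂ (inj₂ _)) (c , _ , e) = 1≢c0 (proj₁ (proj₂ (coords e)))
    injective (inj₂ (inj₂ _)) (inj₁ _) (c , c≢0 , e) = 0≢c1 c≢0 (proj₁ (coords e))
    injective (inj₂ (inj₂ _)) (inj₂ (inj₁ _)) (c , c≢0 , e) =
      0≢c1 c≢0 (proj₁ (proj₂ (coords e)))
    injective (inj₂ (inj₂ tt)) (inj₂ (inj₂ tt)) _ = refl

    injective′ : ∀ {u v} m n → u ∼ v → u ∼ representative m → v ∼ representative n → m ≡ n
    injective′ {u} {v} m n u∼v u∼m v∼n = injective m n
      (∼-trans {representative m} {u} {representative n} (∼-sym {u} {representative m} u∼m)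
        (∼-trans {u} {v} {representative n} u∼v v∼n))

    points↔normal : Inverse pointSetoid (setoid Normal)
    points↔normal = record
      { to        = λ v → proj₁ (normalise v)
      ; from      = representative
      ; to-cong   = λ {u} {v} u∼v →
          injective′ {u} {v} _ _ u∼v (proj₂ (normalise u)) (proj₂ (normalise v))
      ; from-cong = λ { {n} refl → ∼-refl {representative n} }
      ; inverse   =
          (λ {n} {v} v∼n → injective′ {v} {representative n} _ _ v∼n
            (proj₂ (normalise v)) (∼-refl {representative n}))
        , (λ { {v} refl → ∼-sym {v} {representative (proj₁ (normalise v))}
            (proj₂ (normalise v)) })
      }

  -- The projective points (nonzero vectors up to a nonzero scalar) are in
  -- bijection with Fin pointCount, so point sets are subsets of Fin pointCount.
  points : Inverse pointSetoid (setoid (Fin pointCount))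
  points = inverse-∘ points↔normal normal↔Fin

  PointSet : Set
  PointSet = Subset pointCount

  coordinates : Fin pointCount → Vec Carrier 3
  coordinates i = proj₁ (Inverse.from points i)

  -- A line is given by the coefficients of an equation a x + b y + c z = 0.
  Line : Set
  Line = NonzeroVector

  evaluate : Vec Carrier 3 → Vec Carrier 3 → Carrier
  evaluate (a ∷ b ∷ c ∷ []) (x ∷ y ∷ z ∷ []) = a * x + b * y + c * z

  pointsOn : Line → PointSet
  pointsOn (ℓ , _) = tabulate λ i → does (evaluate ℓ (coordinates i) ≟ᶠ 0#)

  IsBlockingSet : PointSet → Set
  IsBlockingSet B = ∀ (ℓ : Line) → Nonempty (pointsOn ℓ ∩ B)

  IsMinimalBlockingSet : PointSet → Set
  IsMinimalBlockingSet B = IsBlockingSet B × (∀ B′ → B′ ⊂ B → ¬ IsBlockingSet B′)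

-- The code C of the points and lines of PG(2,q), with scalars in the field K.
module LineCode {p q : ℕ} (K : FiniteField p) (F : FiniteField q) where
  open FiniteField K
  open ProjectivePlane F using (pointCount; PointSet; Line; pointsOn)

  Word : Set
  Word = Vector Carrier pointCount

  incidenceVector : PointSet → Word
  incidenceVector S i = if lookup S i then 1# else 0#

  infixl 6 _⊖_
  _⊖_ : Word → Word → Word
  (v ⊖ w) i = v i - w i

  infix 7 _·_
  _·_ : Word → Word → Carrier
  v · w = sum λ i → v i * w i

  weight : Word → ℕ
  weight v = ∣ tabulate (λ i → not (does (v i ≟ᶠ 0#))) ∣

  infix 4 _∈C _∈C⊥
  _∈C : Word → Set
  v ∈C = ∃ λ (n : ℕ) → Σ (Vector Carrier n) λ a → Σ (Vector Line n) λ ℓ →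
    ∀ i → v i ≡ sum λ j → a j * incidenceVector (pointsOn (ℓ j)) i

  _∈C⊥ : Word → Set
  v ∈C⊥ = ∀ w → w ∈C → v · w ≡ 0#

{-# OPTIONS --safe #-}

-- Off L the set B has q points U, and every line through a point of L outside B contains
-- exactly one of them. For a line M through a point y of L in B, let the cs be the values of
-- M / L on U; they are the parameters of the lines through y that contain the points of U.
-- The coefficients of ∏ (1 + c T) depend polynomially on y and are known for y outside B, so
-- the first q + 1 - k of them agree with those of ∏ (1 + x T) over the whole field. As
-- 2 k ≤ q + 2, Rédei's lacunary polynomial argument leaves two possibilities: either the
-- product has derivative zero, and then p divides the multiplicity of the root of M, or the
-- two products agree, and then U already blocks all lines through y, so that B is not minimal.
-- Thus every line other than L meets B in 1 modulo p points, and counting B along a pencil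
-- without L gives k ≡ 1 modulo p as well.
module Submission where

open import Defs
import Algebra.Properties.Semiring.Sum as SemiringSum
import Algebra.Solver.Ring.NaturalCoefficients.Default as Solver
open import Algebra.Bundles using (CommutativeRing; module CommutativeSemiring)
open import Data.Bool.Base using (Bool; true; false; if_then_else_; not)
open import Data.Fin.Base using (Fin; zero; suc)
import Data.Fin.Properties as Fin
open import Data.Fin.Subset using (Subset; _∩_; ∁; ⁅_⁆; ∣_∣)
  renaming (_∈_ to _∈ˢ_; _∉_ to _∉ˢ_)
open import Data.Fin.Subset.Properties
  using (_∈?_; drop-there; ⊆-antisym; Empty-unique; ∣⊥∣≡0; ∣⁅x⁆∣≡1; x∈⁅x⁆; x∈⁅y⁆⇒x≡y;
         x∈p∩q⁺; x∈p∩q⁻; x∈∁p⇒x∉p; x∉p⇒x∈∁p; x∈p⇒p-x⊂p; x∈p∧x≢y⇒x∈p-y; ∩-comm; ∩-idem)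
open import Data.List.Base using (List; []; _∷_; _++_; length; map; foldr; tabulate)
open import Data.List.Membership.Propositional using (_∈_; _∉_; find; lose)
open import Data.List.Membership.Propositional.Properties
  using (∈-∃++; ∈-tabulate⁺; ∈-map⁺; ∈-map⁻)
open import Data.List.Properties using (length-map; length-tabulate; map-∘; map-cong)
open import Data.List.Relation.Binary.Permutation.Propositional
  using (_↭_; prep; swap; ↭-refl; ↭-sym; ↭-trans; ↭-prep)
  renaming (refl to refl↭; trans to trans↭)
open import Data.List.Relation.Binary.Permutation.Propositional.Properties
  using (↭-length; ∈-resp-↭; shift)
open import Data.List.Relation.Unary.All using (All; []; _∷_)
import Data.List.Relation.Unary.All as All
open import Data.List.Relation.Unary.Any using (here; there; any?)
import Data.List.Relation.Unary.Any as Any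
open import Data.List.Relation.Unary.Unique.Propositional using (Unique; []; _∷_)
import Data.List.Relation.Unary.Unique.Propositional.Properties as Unique
open import Data.Nat.Base as ℕ
  using (ℕ; zero; suc; z≤n; s≤s; s≤s⁻¹; _≤_; _<_; NonZero; ≢-nonZero)
open import Data.Nat.Coprimality using (prime⇒coprime; coprime-Bézout)
open import Data.Nat.Divisibility using (_∣_; _∣0; divides; m%n≡0⇒n∣m)
open import Data.Nat.DivMod using (_/_; _%_; m≡m%n+[m/n]*n; m%n<n)
open import Data.Nat.GCD using (module Bézout)
open import Data.Nat.Primality using (Prime; prime⇒nonZero)
import Data.Nat.Properties as ℕ
open import Data.Nat.Solver using (module +-*-Solver)
open import Data.Product.Base using (∃; _×_; _,_; proj₁; proj₂)
open import Data.Sum.Base using (_⊎_; inj₁; inj₂; [_,_]′)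
open import Data.Vec.Base as Vec using (Vec; []; _∷_; here; there; replicate; lookup)
import Data.Vec.Properties as Vec
open import Function.Base using (_∘_; id)
open import Function.Bundles using (Inverse)
open import Relation.Binary.PropositionalEquality
open import Relation.Nullary.Decidable
  using (Dec; yes; no; does; ¬?; decidable-stable; dec-true; dec-false)
open import Relation.Nullary.Negation using (¬_; contradiction)

-- Write Q for the product of the 1 + c T, E for the product of the 1 + x T over the whole field,
-- and r = q + 1 - k. In this reversed form a value c = 0 contributes the factor 1, so the
-- multiplicity in question is the drop of the degree of Q below q. The sum of the 1 / (1 + c T),
-- multiplied by Q, is W = - T Q'. Multiplied by E it is again a polynomial N, because every c is an
-- element of the field. Hence E W = Q N, where W and N have degree less than q. The coefficients of
-- Q vanish strictly between 0 and r, those of E strictly between 0 and q - 1. Below degree q the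
-- factor E therefore does not change W, so N vanishes below r as W does; then Q does not change N
-- below 2 r. As q ≤ 2 r, this gives N = W and (E - Q) W = 0. Only coefficients of power series are
-- compared, and no division of polynomials occurs. A line L with a single point of B needs its own
-- argument: then r = q, beyond the gap of E, and L has no second point of B that would block it
-- without y.

-- Lists without repetitions.

unique-⊆⇒↭ : ∀ {A : Set} {xs ys : List A} → Unique xs → (∀ {x} → x ∈ xs → x ∈ ys) →
             length ys ≤ length xs → xs ↭ ys
unique-⊆⇒↭ {xs = []} {[]} _ _ _ = ↭-refl
unique-⊆⇒↭ {xs = x ∷ xs} {ys} (x∉xs ∷ xs!) xs⊆ys len with ∈-∃++ (xs⊆ys (here refl))
... | as , bs , refl = ↭-trans (↭-prep x (unique-⊆⇒↭ xs! sub len′)) (↭-sym moved)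
  where
  moved : as ++ x ∷ bs ↭ x ∷ as ++ bs
  moved = shift x as bs
  sub : ∀ {z} → z ∈ xs → z ∈ as ++ bs
  sub z∈xs with ∈-resp-↭ moved (xs⊆ys (there z∈xs))
  ... | here refl = contradiction refl (All.lookup x∉xs z∈xs)
  ... | there z∈  = z∈
  len′ : length (as ++ bs) ≤ length xs
  len′ = s≤s⁻¹ (subst (_≤ _) (↭-length moved) len)

unique-↭ : ∀ {A : Set} {xs ys : List A} → xs ↭ ys → Unique xs → Unique ys
unique-↭ refl↭ u = u
unique-↭ (prep x p) (x∉ ∷ u) =
  All.tabulate (λ z∈ → All.lookup x∉ (∈-resp-↭ (↭-sym p) z∈)) ∷ unique-↭ p u
unique-↭ (swap x y p) ((x≢y ∷ x∉) ∷ y∉ ∷ u) =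
  (x≢y ∘ sym ∷ All.tabulate (λ z∈ → All.lookup y∉ (∈-resp-↭ (↭-sym p) z∈)))
  ∷ All.tabulate (λ z∈ → All.lookup x∉ (∈-resp-↭ (↭-sym p) z∈)) ∷ unique-↭ p u
unique-↭ (trans↭ p r) u = unique-↭ r (unique-↭ p u)

unique-map⇒injective : ∀ {A B : Set} (f : A → B) {xs : List A} → Unique (map f xs) →
                       ∀ {x y} → x ∈ xs → y ∈ xs → f x ≡ f y → x ≡ y
unique-map⇒injective f (_ ∷ _) (here refl) (here refl) _ = refl
unique-map⇒injective f {_ ∷ xs} (x∉ ∷ _) (here refl) (there y∈) e =
  contradiction e (All.lookup x∉ (∈-map⁺ f y∈))
unique-map⇒injective f {_ ∷ xs} (y∉ ∷ _) (there x∈) (here refl) e =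
  contradiction (sym e) (All.lookup y∉ (∈-map⁺ f x∈))
unique-map⇒injective f (_ ∷ u) (there x∈) (there y∈) e = unique-map⇒injective f u x∈ y∈ e

-- Arithmetic, enumeration and characteristic of a finite field.

module FieldProperties {q : ℕ} (F : FiniteField q) where
  open FiniteField F
  open CommutativeRing commutativeRing public
    using (distribˡ; distribʳ; -‿inverseˡ; -‿inverseʳ; commutativeSemiring)
  module S = Solver commutativeSemiring
  open S using (_:+_; _:*_; _:=_; con)

  1≢0 : 1# ≢ 0#
  1≢0 = 0≢1 ∘ sym

  *-cancelˡ : ∀ x {y z} → x ≢ 0# → x * y ≡ x * z → y ≡ z
  *-cancelˡ x {y} {z} x≢0 e with x⁻¹ , xx⁻¹≡1 ← inverse x x≢0 = begin
    y               ≡⟨ undo y ⟩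
    x⁻¹ * (x * y)   ≡⟨ cong (x⁻¹ *_) e ⟩
    x⁻¹ * (x * z)   ≡⟨ undo z ⟨
    z               ∎
    where
    open ≡-Reasoning
    undo : ∀ w → w ≡ x⁻¹ * (x * w)
    undo w = trans (sym (*-identityˡ w)) (trans (cong (_* w) (sym xx⁻¹≡1))
      (S.solve 3 (λ a b c → a :* b :* c := b :* (a :* c)) refl x x⁻¹ w))

  integral : ∀ x {y} → x ≢ 0# → x * y ≡ 0# → y ≡ 0#
  integral x x≢0 e = *-cancelˡ x x≢0 (trans e (sym (zeroʳ x)))

  *-≢0 : ∀ {x y} → x ≢ 0# → y ≢ 0# → x * y ≢ 0#
  *-≢0 {x} x≢0 y≢0 e = y≢0 (integral x x≢0 e)

  +-cancelˡ : ∀ x {y z} → x + y ≡ x + z → y ≡ z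
  +-cancelˡ x {y} {z} e = trans (undo y) (trans (cong (- x +_) e) (sym (undo z)))
    where
    undo : ∀ w → w ≡ - x + (x + w)
    undo w = trans (sym (+-identityˡ w))
      (trans (cong (_+ w) (sym (-‿inverseˡ x))) (+-assoc (- x) x w))

  +-cancelʳ : ∀ x {y z} → y + x ≡ z + x → y ≡ z
  +-cancelʳ x {y} {z} e = +-cancelˡ x (trans (+-comm x y) (trans e (+-comm z x)))

  -- Made total by the default `inv 0# = 0#`, so that quotients of linear forms such as `coordinate`
  -- and `τ` are functions on all points.
  inv : Carrier → Carrier
  inv x with x ≟ᶠ 0#
  ... | yes _   = 0#
  ... | no  x≢0 = proj₁ (inverse x x≢0)

  inv-inverse : ∀ x → x ≢ 0# → x * inv x ≡ 1#
  inv-inverse x x≢0 with x ≟ᶠ 0#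
  ... | yes x≡0 = contradiction x≡0 x≢0
  ... | no  x≢0 = proj₂ (inverse x x≢0)

  ν : Carrier
  ν = - 1#

  1+ν≡0 : 1# + ν ≡ 0#
  1+ν≡0 = -‿inverseʳ 1#

  ι : ℕ → Carrier
  ι zero    = 0#
  ι (suc n) = 1# + ι n

  ι-+ : ∀ m n → ι (m ℕ.+ n) ≡ ι m + ι n
  ι-+ zero    n = sym (+-identityˡ (ι n))
  ι-+ (suc m) n = trans (cong (1# +_) (ι-+ m n)) (sym (+-assoc 1# (ι m) (ι n)))

  ι-* : ∀ m n → ι (m ℕ.* n) ≡ ι m * ι n
  ι-* zero    n = sym (zeroˡ (ι n))
  ι-* (suc m) n = trans (ι-+ n (m ℕ.* n)) (trans (cong (ι n +_) (ι-* m n))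
    (S.solve 2 (λ a b → b :+ a :* b := (con 1 :+ a) :* b) refl (ι m) (ι n)))

  elements : List Carrier
  elements = tabulate (Inverse.from enumeration)

  length-elements : length elements ≡ q
  length-elements = length-tabulate (Inverse.from enumeration)

  ∈-elements : ∀ x → x ∈ elements
  ∈-elements x = subst (_∈ elements) (Inverse.strictlyInverseʳ enumeration x)
    (∈-tabulate⁺ (Inverse.to enumeration x))

  elements-unique : Unique elements
  elements-unique = Unique.tabulate⁺ λ {i} {j} e →
    trans (sym (Inverse.strictlyInverseˡ enumeration i))
      (trans (cong (Inverse.to enumeration) e) (Inverse.strictlyInverseˡ enumeration j))

  -- Pigeonhole: q entries that cover q elements cannot repeat, so surjectivity alone yields a
  -- permutation.
  covering⇒↭ : ∀ cs → (∀ x → x ∈ cs) → length cs ≡ q → elements ↭ cs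
  covering⇒↭ cs all len = unique-⊆⇒↭ elements-unique (λ {x} _ → all x)
    (ℕ.≤-reflexive (trans len (sym length-elements)))

  remove : ∀ c → ∃ λ cs → elements ↭ c ∷ cs
  remove c with as , bs , e ← ∈-∃++ (∈-elements c) =
    as ++ bs , subst (_↭ c ∷ as ++ bs) (sym e) (shift c as bs)

  others : Carrier → List Carrier
  others c = proj₁ (remove c)

  length-others : ∀ c → suc (length (others c)) ≡ q
  length-others c = trans (sym (↭-length (proj₂ (remove c)))) length-elements

  total : List Carrier → Carrier
  total = foldr _+_ 0#

  total-↭ : ∀ {xs ys} → xs ↭ ys → total xs ≡ total ys
  total-↭ refl↭         = refl
  total-↭ (prep x p)    = cong (x +_) (total-↭ p)
  total-↭ (swap {xs} {ys} x y p) = trans (cong (λ s → x + (y + s)) (total-↭ p))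
    (S.solve 3 (λ a b c → a :+ (b :+ c) := b :+ (a :+ c)) refl x y (total ys))
  total-↭ (trans↭ p r)  = trans (total-↭ p) (total-↭ r)

  total-suc : ∀ xs → total (map (1# +_) xs) ≡ ι (length xs) + total xs
  total-suc []       = sym (+-identityˡ 0#)
  total-suc (x ∷ xs) = trans (cong (1# + x +_) (total-suc xs))
    (S.solve 3 (λ a l t → con 1 :+ a :+ (l :+ t) := con 1 :+ l :+ (a :+ t)) refl
      x (ι (length xs)) (total xs))

  -- x ↦ 1 + x permutes the field, so its elements have the same sum as their translates.
  ι-order : ι q ≡ 0#
  ι-order = +-cancelʳ (total elements) (begin
    ι q + total elements                    ≡⟨ cong (λ l → ι l + total elements) length-elements ⟨
    ι (length elements) + total elements    ≡⟨ total-suc elements ⟨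
    total (map (1# +_) elements)            ≡⟨ total-↭ translated ⟩
    total elements                          ≡⟨ +-identityˡ _ ⟨
    0# + total elements                     ∎)
    where
    open ≡-Reasoning
    translated : map (1# +_) elements ↭ elements
    translated = unique-⊆⇒↭ (Unique.map⁺ (λ {x} {y} → +-cancelˡ 1#) elements-unique)
      (λ {x} _ → ∈-elements x) (ℕ.≤-reflexive (sym (length-map (1# +_) elements)))

  -- A nonzero remainder n % p would be coprime to p, and Bézout would give ι 1 ≡ 0#.
  ι≡0⇒∣ : ∀ {p} → Prime p → ι p ≡ 0# → ∀ n → ι n ≡ 0# → p ∣ n
  ι≡0⇒∣ {p} p-prime ιp≡0 n ιn≡0 = m%n≡0⇒n∣m n p remainder≡0
    where
    instance
      p≢0 : NonZero p
      p≢0 = prime⇒nonZero p-prime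
    r = n % p
    multiple : ∀ m x → ι m ≡ 0# → ι (x ℕ.* m) ≡ 0#
    multiple m x e = trans (ι-* x m) (trans (cong (ι x *_) e) (zeroʳ (ι x)))
    ιr≡0 : ι r ≡ 0#
    ιr≡0 = begin
      ι r                             ≡⟨ +-identityʳ (ι r) ⟨
      ι r + 0#                        ≡⟨ cong (ι r +_) (multiple p (n / p) ιp≡0) ⟨
      ι r + ι (n / p ℕ.* p)           ≡⟨ ι-+ r (n / p ℕ.* p) ⟨
      ι (r ℕ.+ n / p ℕ.* p)           ≡⟨ cong ι (m≡m%n+[m/n]*n n p) ⟨
      ι n                             ≡⟨ ιn≡0 ⟩
      0#                              ∎
      where open ≡-Reasoning
    absurd : ∀ x y m m′ → ι m ≡ 0# → ι m′ ≡ 0# → 1 ℕ.+ x ℕ.* m ≢ y ℕ.* m′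
    absurd x y m m′ em em′ e = 1≢0 (begin
      1#                    ≡⟨ +-identityʳ 1# ⟨
      1# + 0#               ≡⟨ cong (1# +_) (multiple m x em) ⟨
      1# + ι (x ℕ.* m)      ≡⟨ cong ι e ⟩
      ι (y ℕ.* m′)          ≡⟨ multiple m′ y em′ ⟩
      0#                    ∎)
      where open ≡-Reasoning
    remainder≡0 : r ≡ 0
    remainder≡0 with r ℕ.≟ 0
    ... | yes r≡0 = r≡0
    ... | no r≢0
      with coprime-Bézout (prime⇒coprime p-prime {{≢-nonZero r≢0}} (m%n<n n p))
    ...   | Bézout.+- x y e = contradiction e (absurd y x r p ιr≡0 ιp≡0)
    ...   | Bézout.-+ x y e = contradiction e (absurd x y p r ιp≡0 ιr≡0)

  -- There are no zero divisors, so one of the factors p is already zero; this identifies the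
  -- characteristic of a field of order p ^ h.
  ι-^ : ∀ p h → ι (p ℕ.^ h) ≡ 0# → ι p ≡ 0#
  ι-^ p zero    e = contradiction (trans (sym (+-identityʳ 1#)) e) 1≢0
  ι-^ p (suc h) e with ι p ≟ᶠ 0#
  ... | yes ιp≡0 = ιp≡0
  ... | no  ιp≢0 = ι-^ p h (integral (ι p) ιp≢0 (trans (sym (ι-* p (p ℕ.^ h))) e))

-- Power series and elementary symmetric functions.

module Series {q : ℕ} (F : FiniteField q) where
  open FiniteField F
  open FieldProperties F
  open S using (_:+_; _:*_; _:=_; con)

  -- A sequence ℕ → Carrier is read as a power series in T.
  Series : Set
  Series = ℕ → Carrier

  infixl 6 _⊕_
  infixl 7 _⊛_

  0ˢ 1ˢ : Series
  0ˢ _       = 0#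
  1ˢ zero    = 1#
  1ˢ (suc _) = 0#

  _⊕_ : Series → Series → Series
  (a ⊕ b) n = a n + b n

  _⊛_ : Series → Series → Series
  (a ⊛ b) zero    = a 0 * b 0
  (a ⊛ b) (suc n) = a 0 * b (suc n) + ((a ∘ suc) ⊛ b) n

  ⊛-cong : ∀ {a a′ b b′} → a ≗ a′ → b ≗ b′ → a ⊛ b ≗ a′ ⊛ b′
  ⊛-cong ea eb zero    = cong₂ _*_ (ea 0) (eb 0)
  ⊛-cong ea eb (suc n) = cong₂ _+_ (cong₂ _*_ (ea 0) (eb (suc n))) (⊛-cong (ea ∘ suc) eb n)

  ⊛-distribʳ : ∀ c a a′ b n → ((λ i → a i + c * a′ i) ⊛ b) n ≡ (a ⊛ b) n + c * (a′ ⊛ b) n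
  ⊛-distribʳ c a a′ b zero =
    S.solve 4 (λ c a a′ b → (a :+ c :* a′) :* b := a :* b :+ c :* (a′ :* b)) refl
      c (a 0) (a′ 0) (b 0)
  ⊛-distribʳ c a a′ b (suc n) =
    trans (cong ((a 0 + c * a′ 0) * b (suc n) +_) (⊛-distribʳ c (a ∘ suc) (a′ ∘ suc) b n))
      (S.solve 6 (λ c a a′ b x y →
          (a :+ c :* a′) :* b :+ (x :+ c :* y) := a :* b :+ x :+ c :* (a′ :* b :+ y)) refl
        c (a 0) (a′ 0) (b (suc n)) (((a ∘ suc) ⊛ b) n) (((a′ ∘ suc) ⊛ b) n))

  0ˢ-⊛ : ∀ b n → (0ˢ ⊛ b) n ≡ 0#
  0ˢ-⊛ b zero    = zeroˡ (b 0)
  0ˢ-⊛ b (suc n) = trans (cong₂ _+_ (zeroˡ (b (suc n))) (0ˢ-⊛ b n)) (+-identityˡ 0#)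

  1ˢ-⊛ : ∀ b n → (1ˢ ⊛ b) n ≡ b n
  1ˢ-⊛ b zero    = *-identityˡ (b 0)
  1ˢ-⊛ b (suc n) = trans (cong₂ _+_ (*-identityˡ (b (suc n))) (0ˢ-⊛ b n)) (+-identityʳ _)

  -- Orders of vanishing add: if i + j = n < r + s, then i < r or j < s.
  ⊛-order : ∀ r s {a b} n → n < r ℕ.+ s → (∀ i → i < r → a i ≡ 0#) →
            (∀ i → i < s → b i ≡ 0#) → (a ⊛ b) n ≡ 0#
  ⊛-order zero    s {a} zero    n<  az bz = trans (cong (a 0 *_) (bz 0 n<)) (zeroʳ (a 0))
  ⊛-order (suc r) s {b = b} zero n< az bz =
    trans (cong (_* b 0) (az 0 (s≤s z≤n))) (zeroˡ (b 0))
  ⊛-order zero    s {a} (suc n) n<  az bz =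
    trans (cong₂ _+_ (trans (cong (a 0 *_) (bz (suc n) n<)) (zeroʳ (a 0)))
      (⊛-order zero s n (ℕ.<-trans (ℕ.n<1+n n) n<) (λ _ ()) bz)) (+-identityˡ 0#)
  ⊛-order (suc r) s {b = b} (suc n) n< az bz =
    trans (cong₂ _+_ (trans (cong (_* b (suc n)) (az 0 (s≤s z≤n))) (zeroˡ (b (suc n))))
      (⊛-order r s n (s≤s⁻¹ n<) (λ i i< → az (suc i) (s≤s i<)) bz)) (+-identityˡ 0#)

  -- Here a is 1 plus terms of order at least r, so a b and b differ by a product of order at least
  -- r + s. Every use of a gap in the coefficients goes through this lemma.
  ⊛-unit-order : ∀ r s {a b} n → n < r ℕ.+ s → a 0 ≡ 1# →
                 (∀ i → 1 ≤ i → i < r → a i ≡ 0#) → (∀ i → i < s → b i ≡ 0#) →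
                 (a ⊛ b) n ≡ b n
  ⊛-unit-order r s {b = b} zero n< a₀ az bz = trans (cong (_* b 0) a₀) (*-identityˡ (b 0))
  ⊛-unit-order r s {a} {b} (suc n) n< a₀ az bz =
    trans (cong₂ _+_ (trans (cong (_* b (suc n)) a₀) (*-identityˡ _)) (rest r n< az))
      (+-identityʳ _)
    where
    rest : ∀ r → suc n < r ℕ.+ s → (∀ i → 1 ≤ i → i < r → a i ≡ 0#) →
           ((a ∘ suc) ⊛ b) n ≡ 0#
    rest zero    n< az = ⊛-order 0 s n (ℕ.<-trans (ℕ.n<1+n n) n<) (λ _ ()) bz
    rest (suc r) n< az = ⊛-order r s n (s≤s⁻¹ n<) (λ i i< → az (suc i) (s≤s z≤n) (s≤s i<)) bz

  ⊛-shift : ∀ a b → b 0 ≡ 0# → ∀ n → (a ⊛ b) (suc n) ≡ (a ⊛ (b ∘ suc)) n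
  ⊛-shift a b b₀ zero    =
    trans (cong (a 0 * b 1 +_) (trans (cong (a 1 *_) b₀) (zeroʳ (a 1)))) (+-identityʳ _)
  ⊛-shift a b b₀ (suc n) = cong (a 0 * b (suc (suc n)) +_) (⊛-shift (a ∘ suc) b b₀ n)

  -- The index m bounds the order of b. Leading zeros are stripped with `⊛-shift` until the constant
  -- term is invertible; then a is determined coefficient by coefficient.
  ⊛-cancelʳ : ∀ m b → b m ≢ 0# → ∀ {a a′} → a ⊛ b ≗ a′ ⊛ b → a ≗ a′
  ⊛-cancelʳ m b bm≢0 e with b 0 ≟ᶠ 0#
  ⊛-cancelʳ m       b bm≢0 e | no b₀≢0 = go e
    where
    go : ∀ {a a′} → a ⊛ b ≗ a′ ⊛ b → a ≗ a′
    head : ∀ {a a′} → a ⊛ b ≗ a′ ⊛ b → a 0 ≡ a′ 0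
    head {a} {a′} e = *-cancelˡ (b 0) b₀≢0
      (trans (*-comm (b 0) (a 0)) (trans (e 0) (*-comm (a′ 0) (b 0))))
    go e zero    = head e
    go {a} {a′} e (suc n) = go {a ∘ suc} {a′ ∘ suc} (λ i → +-cancelˡ (a 0 * b (suc i))
      (trans (e (suc i)) (cong (λ z → z * b (suc i) + ((a′ ∘ suc) ⊛ b) i) (sym (head e))))) n
  ⊛-cancelʳ zero    b bm≢0 e | yes b₀≡0 = contradiction b₀≡0 bm≢0
  ⊛-cancelʳ (suc m) b bm≢0 {a} {a′} e | yes b₀≡0 = ⊛-cancelʳ m (b ∘ suc) bm≢0 λ n →
    trans (sym (⊛-shift a b b₀≡0 n)) (trans (e (suc n)) (⊛-shift a′ b b₀≡0 n))

  -- Multiplication by 1 + c T.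
  lin : Carrier → Series → Series
  lin c a zero    = a 0
  lin c a (suc n) = a (suc n) + c * a n

  lin-cong : ∀ c {a b} → a ≗ b → lin c a ≗ lin c b
  lin-cong c e zero    = e 0
  lin-cong c e (suc n) = cong₂ (λ x y → x + c * y) (e (suc n)) (e n)

  lin-⊕ : ∀ c a b → lin c (a ⊕ b) ≗ lin c a ⊕ lin c b
  lin-⊕ c a b zero    = refl
  lin-⊕ c a b (suc n) =
    S.solve 5 (λ c x y z w → x :+ y :+ c :* (z :+ w) := x :+ c :* z :+ (y :+ c :* w)) refl
      c (a (suc n)) (b (suc n)) (a n) (b n)

  lin-0ˢ : ∀ c → lin c 0ˢ ≗ 0ˢ
  lin-0ˢ c zero    = refl
  lin-0ˢ c (suc n) = trans (+-identityˡ _) (zeroʳ c)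

  lin-comm : ∀ c d a → lin c (lin d a) ≗ lin d (lin c a)
  lin-comm c d a zero          = refl
  lin-comm c d a (suc zero)    =
    S.solve 4 (λ c d x y → x :+ d :* y :+ c :* y := x :+ c :* y :+ d :* y) refl
      c d (a 1) (a 0)
  lin-comm c d a (suc (suc n)) =
    S.solve 5 (λ c d x y z → x :+ d :* y :+ c :* (y :+ d :* z)
                          := x :+ c :* y :+ d :* (y :+ c :* z)) refl
      c d (a (suc (suc n))) (a (suc n)) (a n)

  lin-⊛ : ∀ c a b → lin c a ⊛ b ≗ lin c (a ⊛ b)
  lin-⊛ c a b zero    = refl
  lin-⊛ c a b (suc n) = trans (cong (a 0 * b (suc n) +_) (⊛-distribʳ c (a ∘ suc) a b n))
    (sym (+-assoc _ _ _))

  -- Multiplication by ∏ (1 + c T) for c in cs.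
  mult : List Carrier → Series → Series
  mult cs a = foldr lin a cs

  -- The elementary symmetric functions of cs.
  e : List Carrier → Series
  e cs = mult cs 1ˢ

  mult-cong : ∀ cs {a b} → a ≗ b → mult cs a ≗ mult cs b
  mult-cong []       eq = eq
  mult-cong (c ∷ cs) eq = lin-cong c (mult-cong cs eq)

  mult-⊕ : ∀ cs a b → mult cs (a ⊕ b) ≗ mult cs a ⊕ mult cs b
  mult-⊕ []       a b n = refl
  mult-⊕ (c ∷ cs) a b n =
    trans (lin-cong c (mult-⊕ cs a b) n) (lin-⊕ c (mult cs a) (mult cs b) n)

  mult-0ˢ : ∀ cs → mult cs 0ˢ ≗ 0ˢ
  mult-0ˢ []       n = refl
  mult-0ˢ (c ∷ cs) n = trans (lin-cong c (mult-0ˢ cs) n) (lin-0ˢ c n)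

  mult-lin : ∀ cs c a → mult cs (lin c a) ≗ lin c (mult cs a)
  mult-lin []       c a n = refl
  mult-lin (d ∷ cs) c a n =
    trans (lin-cong d (mult-lin cs c a) n) (lin-comm d c (mult cs a) n)

  mult-comm : ∀ cs ds a → mult cs (mult ds a) ≗ mult ds (mult cs a)
  mult-comm cs []       a n = refl
  mult-comm cs (d ∷ ds) a n =
    trans (mult-lin cs d (mult ds a) n) (lin-cong d (mult-comm cs ds a) n)

  mult-↭ : ∀ {cs ds} a → cs ↭ ds → mult cs a ≗ mult ds a
  mult-↭ a refl↭        n = refl
  mult-↭ a (prep c p)   n = lin-cong c (mult-↭ a p) n
  mult-↭ a (swap {cs} {ds} c d p) n =
    trans (lin-cong c (lin-cong d (mult-↭ a p)) n) (lin-comm c d (mult ds a) n)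
  mult-↭ a (trans↭ p r) n = trans (mult-↭ a p n) (mult-↭ a r n)

  mult-⊛ : ∀ cs a → mult cs a ≗ e cs ⊛ a
  mult-⊛ []       a n = sym (1ˢ-⊛ a n)
  mult-⊛ (c ∷ cs) a n =
    trans (lin-cong c (mult-⊛ cs a) n) (sym (lin-⊛ c (e cs) a n))

  e-0 : ∀ cs → e cs 0 ≡ 1#
  e-0 []       = refl
  e-0 (c ∷ cs) = e-0 cs

  -- A zero contributes the factor 1, so `nonzeros cs` is the degree of `e cs` and `zeros cs` is its
  -- drop below `length cs`.
  zeros nonzeros : List Carrier → ℕ
  zeros []       = 0
  zeros (c ∷ cs) with c ≟ᶠ 0#
  ... | yes _ = suc (zeros cs)
  ... | no  _ = zeros cs
  nonzeros []       = 0
  nonzeros (c ∷ cs) with c ≟ᶠ 0#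
  ... | yes _ = nonzeros cs
  ... | no  _ = suc (nonzeros cs)

  zeros+nonzeros : ∀ cs → zeros cs ℕ.+ nonzeros cs ≡ length cs
  zeros+nonzeros []       = refl
  zeros+nonzeros (c ∷ cs) with c ≟ᶠ 0#
  ... | yes _ = cong suc (zeros+nonzeros cs)
  ... | no  _ = trans (ℕ.+-suc (zeros cs) (nonzeros cs)) (cong suc (zeros+nonzeros cs))

  e-above : ∀ cs n → nonzeros cs < n → e cs n ≡ 0#
  e-above []       (suc n) _ = refl
  e-above (c ∷ cs) (suc n) < with c ≟ᶠ 0#
  ... | yes refl = trans (cong₂ _+_ (e-above cs (suc n) <) (zeroˡ (e cs n))) (+-identityˡ 0#)
  ... | no  _    = trans (cong₂ (λ x y → x + c * y)
    (e-above cs (suc n) (ℕ.<-trans (ℕ.n<1+n _) <)) (e-above cs n (s≤s⁻¹ <)))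
    (trans (+-identityˡ _) (zeroʳ c))

  e-top : ∀ cs → e cs (nonzeros cs) ≢ 0#
  e-top []       = 1≢0
  e-top (c ∷ cs) with c ≟ᶠ 0#
  ... | yes refl = λ eq → e-top cs (trans (sym (lin-0 (e cs) (nonzeros cs))) eq)
    where
    lin-0 : ∀ a n → lin 0# a n ≡ a n
    lin-0 a zero    = refl
    lin-0 a (suc n) = trans (cong (a (suc n) +_) (zeroˡ (a n))) (+-identityʳ _)
  ... | no c≢0 = λ eq → *-≢0 c≢0 (e-top cs) (trans (sym (+-identityˡ _))
    (trans (cong (_+ c * e cs (nonzeros cs)) (sym (e-above cs _ (ℕ.n<1+n _)))) eq))

  e-degree : ∀ cs n → length cs < n → e cs n ≡ 0#
  e-degree cs n < = e-above cs n (ℕ.≤-<-trans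
    (subst (nonzeros cs ≤_) (zeros+nonzeros cs) (ℕ.m≤n+m (nonzeros cs) (zeros cs))) <)

  -- The expansion of 1 / (1 + c T).
  geometric : Carrier → Series
  geometric c zero    = 1#
  geometric c (suc n) = - c * geometric c n

  ∏-shift : Carrier → List Carrier → Carrier
  ∏-shift c = foldr (λ d x → (d + - c) * x) 1#

  -- The tail of ∏ (1 + d T) / (1 + c T) evaluates the numerator at T = - 1 / c, homogenised
  -- so that c = 0 is allowed.
  mult-geometric : ∀ c cs n →
    mult cs (geometric c) (length cs ℕ.+ n) ≡ ∏-shift c cs * geometric c n
  mult-geometric c []       n = sym (*-identityˡ _)
  mult-geometric c (d ∷ cs) n = begin
    mult cs g (suc (length cs ℕ.+ n)) + d * mult cs g (length cs ℕ.+ n)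
      ≡⟨ cong₂ (λ i y → mult cs g i + d * y) (sym (ℕ.+-suc (length cs) n)) (mult-geometric c cs n) ⟩
    mult cs g (length cs ℕ.+ suc n) + d * (∏-shift c cs * g n)
      ≡⟨ cong (_+ d * (∏-shift c cs * g n)) (mult-geometric c cs (suc n)) ⟩
    ∏-shift c cs * (- c * g n) + d * (∏-shift c cs * g n)
      ≡⟨ S.solve 4 (λ d m P x → P :* (m :* x) :+ d :* (P :* x) := (d :+ m) :* P :* x) refl
           d (- c) (∏-shift c cs) (g n) ⟩
    (d + - c) * ∏-shift c cs * g n ∎
    where
    open ≡-Reasoning
    g = geometric c

  ∏-shift≡0⇒∈ : ∀ c cs → ∏-shift c cs ≡ 0# → c ∈ cs
  ∏-shift≡0⇒∈ c []       eq = contradiction eq 1≢0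
  ∏-shift≡0⇒∈ c (d ∷ cs) eq with c ≟ᶠ d
  ... | yes c≡d = here c≡d
  ... | no  c≢d = there (∏-shift≡0⇒∈ c cs (integral (d + - c)
    (λ z → c≢d (sym (+-cancelʳ (- c) (trans z (sym (-‿inverseʳ c)))))) eq))

  ∈⇒∏-shift≡0 : ∀ {c cs} → c ∈ cs → ∏-shift c cs ≡ 0#
  ∈⇒∏-shift≡0 {c} {_ ∷ cs} (here refl) = trans (cong (_* ∏-shift c cs) (-‿inverseʳ c)) (zeroˡ _)
  ∈⇒∏-shift≡0 {c} {d ∷ _} (there c∈) =
    trans (cong ((d + - c) *_) (∈⇒∏-shift≡0 c∈)) (zeroʳ _)

  -- By `mult-geometric` the coefficient of `e cs ⊛ geometric c` at `length cs` is the product of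
  -- the differences d - c, which vanishes exactly if c occurs. It depends only on `e cs` and the
  -- length; the length is what detects c = 0, to which `e` is blind.
  e-determines-∈ : ∀ {cs ds c} → length cs ≡ length ds → e cs ≗ e ds → c ∈ ds → c ∈ cs
  e-determines-∈ {cs} {ds} {c} len eq c∈ = ∏-shift≡0⇒∈ c cs (begin
    ∏-shift c cs                       ≡⟨ evaluate cs ⟨
    mult cs g (length cs ℕ.+ 0)        ≡⟨ mult-⊛ cs g _ ⟩
    (e cs ⊛ g) (length cs ℕ.+ 0)       ≡⟨ ⊛-cong {b = g} eq (λ _ → refl) (length cs ℕ.+ 0) ⟩
    (e ds ⊛ g) (length cs ℕ.+ 0)       ≡⟨ cong (λ l → (e ds ⊛ g) (l ℕ.+ 0)) len ⟩
    (e ds ⊛ g) (length ds ℕ.+ 0)       ≡⟨ mult-⊛ ds g _ ⟨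
    mult ds g (length ds ℕ.+ 0)        ≡⟨ evaluate ds ⟩
    ∏-shift c ds                       ≡⟨ ∈⇒∏-shift≡0 c∈ ⟩
    0#                                 ∎)
    where
    open ≡-Reasoning
    g = geometric c
    evaluate : ∀ cs → mult cs g (length cs ℕ.+ 0) ≡ ∏-shift c cs
    evaluate cs = trans (mult-geometric c cs 0) (*-identityʳ _)

  -- ∑ over the positions of cs of the product of the other factors 1 + c T.
  cofactors : List Carrier → Series
  cofactors []       = 0ˢ
  cofactors (c ∷ cs) = e cs ⊕ lin c (cofactors cs)

  -- With Q = `e cs`, the identity 1 / (1 + c T) = 1 - c T / (1 + c T) shows that the cofactors add
  -- up to `length cs` times Q minus T Q', and T Q' has the coefficients `ι n * e cs n`. For a list
  -- of length q only - T Q' remains.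
  cofactors-coefficient : ∀ cs n → cofactors cs n + ι n * e cs n ≡ ι (length cs) * e cs n
  cofactors-coefficient [] zero    = +-identityˡ _
  cofactors-coefficient [] (suc n) =
    S.solve 1 (λ a → con 0 :+ a :* con 0 := con 0 :* con 0) refl (ι (suc n))
  cofactors-coefficient (c ∷ cs) zero = begin
    e cs 0 + cofactors cs 0 + 0# * e cs 0
      ≡⟨ +-assoc _ _ _ ⟩
    e cs 0 + (cofactors cs 0 + 0# * e cs 0)
      ≡⟨ cong (e cs 0 +_) (cofactors-coefficient cs 0) ⟩
    e cs 0 + ι (length cs) * e cs 0
      ≡⟨ S.solve 2 (λ x l → x :+ l :* x := (con 1 :+ l) :* x) refl (e cs 0) (ι (length cs)) ⟩
    (1# + ι (length cs)) * e cs 0 ∎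
    where open ≡-Reasoning
  cofactors-coefficient (c ∷ cs) (suc n) = begin
    x + (w + c * v) + (1# + i) * (x + c * y)
      ≡⟨ S.solve 6 (λ x w c v i y → x :+ (w :+ c :* v) :+ (con 1 :+ i) :* (x :+ c :* y)
           := x :+ (w :+ (con 1 :+ i) :* x) :+ c :* (y :+ (v :+ i :* y))) refl x w c v i y ⟩
    x + (w + (1# + i) * x) + c * (y + (v + i * y))
      ≡⟨ cong₂ (λ a b → x + a + c * (y + b))
           (cofactors-coefficient cs (suc n)) (cofactors-coefficient cs n) ⟩
    x + l * x + c * (y + l * y)
      ≡⟨ S.solve 4 (λ x l c y → x :+ l :* x :+ c :* (y :+ l :* y)
           := (con 1 :+ l) :* (x :+ c :* y)) refl x l c y ⟩
    (1# + l) * (x + c * y) ∎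
    where
    open ≡-Reasoning
    x = e cs (suc n)
    y = e cs n
    w = cofactors cs (suc n)
    v = cofactors cs n
    i = ι n
    l = ι (length cs)

  -- The same sum of reciprocals 1 / (1 + c T), cleared of denominators by the product over the
  -- field instead of `e cs`. This works whatever repetitions `cs` has, since each summand has only
  -- one denominator.
  field-cofactors : List Carrier → Series
  field-cofactors []       = 0ˢ
  field-cofactors (c ∷ cs) = e (others c) ⊕ field-cofactors cs

  -- Both sides are ∏ over cs times ∏ over the field times ∑ 1 / (1 + c T).
  cofactor-identity : ∀ cs →
    mult elements (cofactors cs) ≗ mult cs (field-cofactors cs)
  cofactor-identity []       n = mult-0ˢ elements n
  cofactor-identity (c ∷ cs) n = begin
    mult els (e cs ⊕ lin c W) n
      ≡⟨ mult-⊕ els (e cs) (lin c W) n ⟩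
    mult els (e cs) n + mult els (lin c W) n
      ≡⟨ cong₂ _+_ left (trans (mult-lin els c W n) (lin-cong c (cofactor-identity cs) n)) ⟩
    lin c (mult cs (e os)) n + lin c (mult cs M) n
      ≡⟨ lin-⊕ c (mult cs (e os)) (mult cs M) n ⟨
    lin c (mult cs (e os) ⊕ mult cs M) n
      ≡⟨ lin-cong c (mult-⊕ cs (e os) M) n ⟨
    lin c (mult cs (e os ⊕ M)) n ∎
    where
    open ≡-Reasoning
    els = elements
    os = others c
    W = cofactors cs
    M = field-cofactors cs
    left : mult els (e cs) n ≡ lin c (mult cs (e os)) n
    left = begin
      mult els (mult cs 1ˢ) n     ≡⟨ mult-comm els cs 1ˢ n ⟩
      mult cs (mult els 1ˢ) n     ≡⟨ mult-cong cs (mult-↭ 1ˢ (proj₂ (remove c))) n ⟩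
      mult cs (lin c (e os)) n    ≡⟨ mult-lin cs c (e os) n ⟩
      lin c (mult cs (e os)) n    ∎

  field-cofactors-degree : ∀ cs n → q ≤ n → field-cofactors cs n ≡ 0#
  field-cofactors-degree []       n q≤n = refl
  field-cofactors-degree (c ∷ cs) n q≤n = trans (cong₂ _+_
    (e-degree (others c) n (subst (_≤ n) (sym (length-others c)) q≤n))
    (field-cofactors-degree cs n q≤n)) (+-identityˡ 0#)

-- Polynomial functions and the lacunary argument.

module Lacunary {q : ℕ} (F : FiniteField q) where
  open FiniteField F
  open FieldProperties F
  open Series F
  open S using (_:+_; _:*_; _:=_)

  -- Polynomial functions of degree at most d, described by iterated difference quotients.
  Degree≤ : ℕ → (Carrier → Carrier) → Set
  Degree≤ zero    f = ∀ x y → f x ≡ f y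
  Degree≤ (suc d) f = ∀ a → ∃ λ g → Degree≤ d g × (∀ x → f x ≡ f a + (x + - a) * g x)

  degree-const : ∀ d c → Degree≤ d (λ _ → c)
  degree-const zero    c = λ _ _ → refl
  degree-const (suc d) c = λ a → (λ _ → 0#) , degree-const d 0# ,
    λ x → sym (trans (cong (c +_) (zeroʳ (x + - a))) (+-identityʳ c))

  degree-+ : ∀ d {f g} → Degree≤ d f → Degree≤ d g → Degree≤ d (λ x → f x + g x)
  degree-+ zero    Df Dg = λ x y → cong₂ _+_ (Df x y) (Dg x y)
  degree-+ (suc d) {f} {g} Df Dg a with f′ , Df′ , ef ← Df a | g′ , Dg′ , eg ← Dg a =
    (λ x → f′ x + g′ x) , degree-+ d Df′ Dg′ , λ x → trans (cong₂ _+_ (ef x) (eg x))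
      (S.solve 5 (λ fa ga h u v → fa :+ h :* u :+ (ga :+ h :* v) := fa :+ ga :+ h :* (u :+ v))
        refl (f a) (g a) (x + - a) (f′ x) (g′ x))

  degree-affine-* : ∀ d α β {f} → Degree≤ d f → Degree≤ (suc d) (λ x → (α + x * β) * f x)

  -- The product rule turns a difference quotient g of f into `c + (α + x * β) * g x` with c =
  -- `β * f a`, and this has to have degree at most d. For d = 0 the function f is constant,
  -- `Degree≤` supplies no quotient, and g = 0 is taken.
  slope : ∀ d {f} → Degree≤ d f → ∀ α β c a → ∃ λ (g : Carrier → Carrier) →
          Degree≤ d (λ x → c + (α + x * β) * g x) × (∀ x → f x ≡ f a + (x + - a) * g x)
  slope zero    {f} Df α β c a = (λ _ → 0#) ,
    (λ x y → cong (c +_) (trans (zeroʳ _) (sym (zeroʳ _)))) ,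
    λ x → trans (Df x a) (sym (trans (cong (f a +_) (zeroʳ _)) (+-identityʳ _)))
  slope (suc d) {f} Df α β c a = proj₁ (Df a) ,
    degree-+ (suc d) (degree-const (suc d) c) (degree-affine-* d α β (proj₁ (proj₂ (Df a)))) ,
    proj₂ (proj₂ (Df a))

  degree-affine-* d α β {f} Df a with g , Dg , eq ← slope d Df α β (β * f a) a =
    (λ x → β * f a + (α + x * β) * g x) , Dg , λ x → begin
    (α + x * β) * f x
      ≡⟨ cong ((α + x * β) *_) (eq x) ⟩
    (α + x * β) * (f a + (x + - a) * g x)
      ≡⟨ distribˡ (α + x * β) (f a) ((x + - a) * g x) ⟩
    (α + x * β) * f a + (α + x * β) * ((x + - a) * g x)
      ≡⟨ cong (λ z → (α + z * β) * f a + (α + x * β) * ((x + - a) * g x)) (shifted x) ⟩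
    (α + (a + (x + - a)) * β) * f a + (α + x * β) * ((x + - a) * g x)
      ≡⟨ S.solve 7 (λ α β a h fa l gx →
           (α :+ (a :+ h) :* β) :* fa :+ l :* (h :* gx)
           := (α :+ a :* β) :* fa :+ h :* (β :* fa :+ l :* gx)) refl
           α β a (x + - a) (f a) (α + x * β) (g x) ⟩
    (α + a * β) * f a + (x + - a) * (β * f a + (α + x * β) * g x) ∎
    where
    open ≡-Reasoning
    shifted : ∀ x → x ≡ a + (x + - a)
    shifted x = sym (trans (S.solve 3 (λ a x m → a :+ (x :+ m) := x :+ (a :+ m)) refl a x (- a))
      (trans (cong (x +_) (-‿inverseʳ a)) (+-identityʳ x)))

  x-y≡0⇒x≡y : ∀ {x y} → x + - y ≡ 0# → x ≡ y
  x-y≡0⇒x≡y {x} {y} eq = +-cancelʳ (- y) (trans eq (sym (-‿inverseʳ y)))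

  degree-vanish : ∀ d {f} → Degree≤ d f → ∀ {xs} → Unique xs → d < length xs →
                  All (λ x → f x ≡ 0#) xs → ∀ x → f x ≡ 0#
  degree-vanish zero    Df {a ∷ xs} _ _ (fa≡0 ∷ _) x = trans (Df x a) fa≡0
  degree-vanish (suc d) {f} Df {a ∷ xs} (a∉ ∷ xs!) d< (fa≡0 ∷ fxs≡0) x
    with g , Dg , eq ← Df a = begin
      f x                     ≡⟨ eq x ⟩
      f a + (x + - a) * g x   ≡⟨ cong₂ (λ u v → u + (x + - a) * v) fa≡0 (vanish x) ⟩
      0# + (x + - a) * 0#     ≡⟨ trans (+-identityˡ _) (zeroʳ _) ⟩
      0#                      ∎
    where
    open ≡-Reasoning
    zero-of-g : ∀ {z} → z ∈ xs → g z ≡ 0#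
    zero-of-g {z} z∈ = integral (z + - a)
      (λ z-a≡0 → All.lookup a∉ z∈ (sym (x-y≡0⇒x≡y z-a≡0)))
      (trans (sym (+-identityˡ _)) (trans (cong (_+ (z + - a) * g z) (sym fa≡0))
        (trans (sym (eq z)) (All.lookup fxs≡0 z∈))))
    vanish : ∀ x → g x ≡ 0#
    vanish = degree-vanish d Dg xs! (s≤s⁻¹ d<) (All.tabulate zero-of-g)

  -- The j-th coefficient is a sum of products of j entries, each of them affine in t.
  e-degree≤ : ∀ {A : Set} (α β : A → Carrier) us j →
              Degree≤ j (λ t → e (map (λ u → α u + t * β u) us) j)
  e-degree≤ α β []       zero    = degree-const 0 1#
  e-degree≤ α β []       (suc j) = degree-const (suc j) 0#
  e-degree≤ α β (u ∷ us) zero    = e-degree≤ α β us zero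
  e-degree≤ α β (u ∷ us) (suc j) = degree-+ (suc j) (e-degree≤ α β us (suc j))
    (degree-affine-* j (α u) (β u) (e-degree≤ α β us j))

  others-nonzero : ∀ {t} → t ∈ others 0# → t ≢ 0#
  others-nonzero t∈ refl with unique-↭ (proj₂ (remove 0#)) elements-unique
  ... | 0∉ ∷ _ = All.lookup 0∉ t∈ refl

  -- Subtracting c leaves a polynomial of degree at most j in t, so j + 1 distinct parameters
  -- decide.
  e-vanish : ∀ j {A : Set} (α β : A → Carrier) us c {ts} → Unique ts → j < length ts →
             (∀ {t} → t ∈ ts → e (map (λ u → α u + t * β u) us) j ≡ c) →
             ∀ t → e (map (λ u → α u + t * β u) us) j ≡ c
  e-vanish j α β us c ts! j< eq t = x-y≡0⇒x≡y (degree-vanish j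
    (degree-+ j (e-degree≤ α β us j) (degree-const j (- c))) ts! j<
    (All.tabulate λ t∈ → trans (cong (_+ - c) (eq t∈)) (-‿inverseʳ c)) t)

  -- Scaling by t ≢ 0 permutes the field, so e j (t · elements) is a polynomial in t of degree
  -- at most j that is constant for t ≢ 0; for t = 0 it is zero.
  e-elements : ∀ j → 1 ≤ j → suc j < q → e elements j ≡ 0#
  e-elements (suc j) _ j+2<q = trans
    (sym (e-vanish (suc j) (λ _ → 0#) id elements (e elements (suc j)) nonzero-unique
      (s≤s⁻¹ (subst (suc (suc j) <_) (sym (length-others 0#)) j+2<q)) scale 0#))
    (collapse elements j)
    where
    collapse : ∀ cs j → e (map (λ c → 0# + 0# * c) cs) (suc j) ≡ 0#
    collapse []       j = refl
    collapse (c ∷ cs) j = trans (cong₂ _+_ (collapse cs j)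
      (trans (cong (_* e (map (λ c → 0# + 0# * c) cs) j)
        (trans (+-identityˡ _) (zeroˡ c))) (zeroˡ _))) (+-identityˡ 0#)
    nonzero-unique : Unique (others 0#)
    nonzero-unique with unique-↭ (proj₂ (remove 0#)) elements-unique
    ... | _ ∷ u = u
    scale : ∀ {t} → t ∈ others 0# →
            e (map (λ c → 0# + t * c) elements) (suc j) ≡ e elements (suc j)
    scale {t} t∈ = mult-↭ 1ˢ (unique-⊆⇒↭ (Unique.map⁺ injective elements-unique)
      (λ {x} _ → ∈-elements x) (ℕ.≤-reflexive (sym (length-map _ elements)))) (suc j)
      where
      injective : ∀ {x y} → 0# + t * x ≡ 0# + t * y → x ≡ y
      injective eq = *-cancelˡ t (others-nonzero t∈) (+-cancelˡ 0# eq)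

  module _ {cs : List Carrier} (length≡q : length cs ≡ q) where

    cofactors-field : ∀ n → cofactors cs n + ι n * e cs n ≡ 0#
    cofactors-field n = trans (cofactors-coefficient cs n)
      (trans (cong (λ l → ι l * e cs n) length≡q) (trans (cong (_* e cs n) ι-order) (zeroˡ _)))

    cofactors-zero : ∀ n → ι n * e cs n ≡ 0# → cofactors cs n ≡ 0#
    cofactors-zero n eq =
      trans (sym (+-identityʳ _)) (trans (cong (cofactors cs n +_) (sym eq)) (cofactors-field n))

    cofactors-0 : cofactors cs 0 ≡ 0#
    cofactors-0 = cofactors-zero 0 (zeroˡ _)

    cofactors-degree : ∀ n → q ≤ n → cofactors cs n ≡ 0#
    cofactors-degree n q≤n with q ℕ.≟ n
    -- In degree q the coefficient of `e cs` may be nonzero; the factor `ι q` kills it.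
    ... | yes refl = cofactors-zero n (trans (cong (_* e cs n) ι-order) (zeroˡ _))
    ... | no  q≢n  = cofactors-zero n (trans (cong (ι n *_)
      (e-degree cs n (subst (_< n) (sym length≡q) (ℕ.≤∧≢⇒< q≤n q≢n)))) (zeroʳ _))

    -- The derivative being zero, `ι n` annihilates the n-th coefficient for every n. For n =
    -- `nonzeros cs` that coefficient is the nonzero leading one, so the degree is zero in the
    -- field, and with it its complement in q.
    cofactors≡0⇒ι-zeros : (∀ n → cofactors cs n ≡ 0#) → ι (zeros cs) ≡ 0#
    cofactors≡0⇒ι-zeros W≡0 = begin
      ι (zeros cs)                         ≡⟨ +-identityʳ _ ⟨
      ι (zeros cs) + 0#                    ≡⟨ cong (ι (zeros cs) +_) ι-nonzeros ⟨
      ι (zeros cs) + ι (nonzeros cs)       ≡⟨ ι-+ (zeros cs) (nonzeros cs) ⟨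
      ι (zeros cs ℕ.+ nonzeros cs)         ≡⟨ cong ι (trans (zeros+nonzeros cs) length≡q) ⟩
      ι q                                  ≡⟨ ι-order ⟩
      0#                                   ∎
      where
      open ≡-Reasoning
      ι-nonzeros : ι (nonzeros cs) ≡ 0#
      ι-nonzeros = integral (e cs (nonzeros cs)) (e-top cs) (trans (*-comm _ _)
        (trans (sym (+-identityˡ _)) (trans
          (cong (_+ ι (nonzeros cs) * e cs (nonzeros cs)) (sym (W≡0 (nonzeros cs))))
          (cofactors-field (nonzeros cs)))))

    module _ (r : ℕ) (r≤q : r ≤ q) (q≤2r : q ≤ r ℕ.+ r)
             (gap : ∀ j → 1 ≤ j → j < r → e cs j ≡ 0#) where
      private
        W M : Series
        W = cofactors cs
        M = field-cofactors cs

        product : e elements ⊛ W ≗ e cs ⊛ M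
        product n = trans (sym (mult-⊛ elements W n))
          (trans (cofactor-identity cs n) (mult-⊛ cs M n))

        -- `e elements` is 1 up to order q - 1 and W has no constant term; the two orders add up to
        -- q.
        elements-W : ∀ n → n < q → (e elements ⊛ W) n ≡ W n
        elements-W n n<q = ⊛-unit-order m 1 n
          (subst (n <_) (trans (sym (length-others 0#)) (ℕ.+-comm 1 m)) n<q) (e-0 elements)
          (λ i 1≤i i<m → e-elements i 1≤i (subst (suc i <_) (length-others 0#) (s≤s i<m)))
          λ { zero _ → cofactors-0 ; (suc _) (s≤s ()) }
          where m = length (others 0#)

        W-low : ∀ n → n < r → W n ≡ 0#
        W-low zero    _   = cofactors-0
        W-low (suc n) n<r = cofactors-zero (suc n)
          (trans (cong (ι (suc n) *_) (gap (suc n) (s≤s z≤n) n<r)) (zeroʳ _))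

        -- Below r the factor `e cs` acts as 1 on any series, hence the order 0 for M, about which
        -- nothing is known yet.
        M-low : ∀ n → n < r → M n ≡ 0#
        M-low n n<r = begin
          M n                      ≡⟨ ⊛-unit-order r 0 n (subst (n <_) (sym (ℕ.+-identityʳ r)) n<r)
                                        (e-0 cs) gap (λ _ ()) ⟨
          (e cs ⊛ M) n             ≡⟨ product n ⟨
          (e elements ⊛ W) n       ≡⟨ elements-W n (ℕ.<-≤-trans n<r r≤q) ⟩
          W n                      ≡⟨ W-low n n<r ⟩
          0#                       ∎
          where open ≡-Reasoning

        -- From q on both sides vanish. Now that M is known to have order r, `e cs` leaves it
        -- unchanged below r + r, and q ≤ r + r covers the remaining degrees.
        M≗W : M ≗ W
        M≗W n with n ℕ.<? q
        ... | no  n≮q = trans (field-cofactors-degree cs n (ℕ.≮⇒≥ n≮q))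
                          (sym (cofactors-degree n (ℕ.≮⇒≥ n≮q)))
        ... | yes n<q = trans
          (sym (⊛-unit-order r r n (ℕ.<-≤-trans n<q q≤2r) (e-0 cs) gap M-low))
          (trans (sym (product n)) (elements-W n n<q))

        zero? : ∀ m → (∀ n → n < m → W n ≡ 0#) ⊎ ∃ λ n → W n ≢ 0#
        zero? zero    = inj₁ λ _ ()
        zero? (suc m) with zero? m | W m ≟ᶠ 0#
        ... | inj₂ nz | _      = inj₂ nz
        ... | _       | no nz  = inj₂ (m , nz)
        ... | inj₁ z  | yes zm = inj₁ below
          where
          below : ∀ n → n < suc m → W n ≡ 0#
          below n n< with n ℕ.≟ m
          ... | yes refl = zm
          ... | no  n≢m  = z n (ℕ.≤∧≢⇒< (s≤s⁻¹ n<) n≢m)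

      -- Since M = W, the two products agree after multiplication by W. Either W vanishes, and with
      -- it the derivative, or W can be cancelled and `cs` has the symmetric functions of the whole
      -- field.
      lacunary : ι (zeros cs) ≡ 0# ⊎ (∀ c → c ∈ cs)
      lacunary with zero? q
      ... | inj₁ low = inj₁ (cofactors≡0⇒ι-zeros all-zero)
        where
        all-zero : ∀ n → W n ≡ 0#
        all-zero n with n ℕ.<? q
        ... | yes n<q = low n n<q
        ... | no  n≮q = cofactors-degree n (ℕ.≮⇒≥ n≮q)
      ... | inj₂ (m , Wm≢0) = inj₂ λ c → e-determines-∈ (trans length≡q (sym length-elements))
        (⊛-cancelʳ m W Wm≢0 λ n →
          trans (⊛-cong {a = e cs} (λ _ → refl) (sym ∘ M≗W) n) (sym (product n)))
        (∈-elements c)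

-- Incidence in homogeneous coordinates by cross products.

does-true : ∀ {P : Set} (P? : Dec P) → does P? ≡ true → P
does-true (yes p) _ = p

module Geometry {q : ℕ} (F : FiniteField q) where
  open FiniteField F
  open FieldProperties F
  open ProjectivePlane F
  open S using (_:+_; _:*_; _:=_; con)

  𝟎 : Vec Carrier 3
  𝟎 = replicate 3 0#

  vec≡ : ∀ {x y z x′ y′ z′ : Carrier} → x ≡ x′ → y ≡ y′ → z ≡ z′ →
         _≡_ {A = Vec Carrier 3} (x ∷ y ∷ z ∷ []) (x′ ∷ y′ ∷ z′ ∷ [])
  vec≡ refl refl refl = refl

  -- Since 1 + ν ≡ 0, identities involving ν = - 1 are semiring identities up to its multiples.
  modulo-1+ν : ∀ x y {a b} → a + (1# + ν) * x ≡ b + (1# + ν) * y → a ≡ b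
  modulo-1+ν x y eq = trans (sym (drop x)) (trans eq (drop y))
    where
    drop : ∀ x {a} → a + (1# + ν) * x ≡ a
    drop x {a} = trans (cong (λ z → a + z * x) 1+ν≡0)
      (trans (cong (a +_) (zeroˡ x)) (+-identityʳ a))

  x+νy≡0⇒x≡y : ∀ {x y} → x + ν * y ≡ 0# → x ≡ y
  x+νy≡0⇒x≡y {x} {y} eq = modulo-1+ν y 0# (trans
    (S.solve 3 (λ x y ν → x :+ (con 1 :+ ν) :* y := (x :+ ν :* y) :+ y) refl x y ν)
    (trans (cong (_+ y) eq)
      (S.solve 2 (λ y ν → con 0 :+ y := y :+ (con 1 :+ ν) :* con 0) refl y ν)))

  x+νx≡0 : ∀ x → x + ν * x ≡ 0#
  x+νx≡0 x = modulo-1+ν 0# x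
    (S.solve 2 (λ x ν → x :+ ν :* x :+ (con 1 :+ ν) :* con 0 := con 0 :+ (con 1 :+ ν) :* x)
      refl x ν)

  cross : Vec Carrier 3 → Vec Carrier 3 → Vec Carrier 3
  cross (a ∷ b ∷ c ∷ []) (x ∷ y ∷ z ∷ []) =
    (b * z + ν * (c * y)) ∷ (c * x + ν * (a * z)) ∷ (a * y + ν * (b * x)) ∷ []

  add-multiple : Vec Carrier 3 → Carrier → Vec Carrier 3 → Vec Carrier 3
  add-multiple (a ∷ b ∷ c ∷ []) t (x ∷ y ∷ z ∷ []) =
    (a + t * x) ∷ (b + t * y) ∷ (c + t * z) ∷ []

  evaluate-add-multiple : ∀ m t n v →
    evaluate (add-multiple m t n) v ≡ evaluate m v + t * evaluate n v
  evaluate-add-multiple (a ∷ b ∷ c ∷ []) t (x ∷ y ∷ z ∷ []) (r ∷ s ∷ u ∷ []) =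
    S.solve 10 (λ a b c t x y z r s u →
      (a :+ t :* x) :* r :+ (b :+ t :* y) :* s :+ (c :+ t :* z) :* u
      := a :* r :+ b :* s :+ c :* u :+ t :* (x :* r :+ y :* s :+ z :* u)) refl
      a b c t x y z r s u

  evaluate-scaleˡ : ∀ c m v → evaluate (Vec.map (c *_) m) v ≡ c * evaluate m v
  evaluate-scaleˡ d (a ∷ b ∷ c ∷ []) (r ∷ s ∷ u ∷ []) =
    S.solve 7 (λ d a b c r s u → d :* a :* r :+ d :* b :* s :+ d :* c :* u
      := d :* (a :* r :+ b :* s :+ c :* u)) refl d a b c r s u

  evaluate-comm : ∀ m v → evaluate m v ≡ evaluate v m
  evaluate-comm (a ∷ b ∷ c ∷ []) (r ∷ s ∷ u ∷ []) =
    S.solve 6 (λ a b c r s u → a :* r :+ b :* s :+ c :* u := r :* a :+ s :* b :+ u :* c) refl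
      a b c r s u

  evaluate-scaleʳ : ∀ c m v → evaluate m (Vec.map (c *_) v) ≡ c * evaluate m v
  evaluate-scaleʳ c m v = trans (evaluate-comm m _)
    (trans (evaluate-scaleˡ c v m) (cong (c *_) (evaluate-comm v m)))

  evaluate-crossˡ : ∀ m n → evaluate m (cross m n) ≡ 0#
  evaluate-crossˡ (a ∷ b ∷ c ∷ []) (x ∷ y ∷ z ∷ []) =
    modulo-1+ν 0# (a * b * z + b * c * x + c * a * y)
      (S.solve 7 (λ a b c x y z ν →
        a :* (b :* z :+ ν :* (c :* y)) :+ b :* (c :* x :+ ν :* (a :* z))
          :+ c :* (a :* y :+ ν :* (b :* x)) :+ (con 1 :+ ν) :* con 0
        := con 0 :+ (con 1 :+ ν) :* (a :* b :* z :+ b :* c :* x :+ c :* a :* y)) refl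
        a b c x y z ν)

  evaluate-crossʳ : ∀ m n → evaluate n (cross m n) ≡ 0#
  evaluate-crossʳ (a ∷ b ∷ c ∷ []) (x ∷ y ∷ z ∷ []) =
    modulo-1+ν 0# (x * b * z + y * c * x + z * a * y)
      (S.solve 7 (λ a b c x y z ν →
        x :* (b :* z :+ ν :* (c :* y)) :+ y :* (c :* x :+ ν :* (a :* z))
          :+ z :* (a :* y :+ ν :* (b :* x)) :+ (con 1 :+ ν) :* con 0
        := con 0 :+ (con 1 :+ ν) :* (x :* b :* z :+ y :* c :* x :+ z :* a :* y)) refl
        a b c x y z ν)

  cross-0ˡ : ∀ n → cross 𝟎 n ≡ 𝟎
  cross-0ˡ (x ∷ y ∷ z ∷ []) = vec≡ (zero-entry z y) (zero-entry x z) (zero-entry y x)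
    where
    zero-entry : ∀ x y → 0# * x + ν * (0# * y) ≡ 0#
    zero-entry x y = S.solve 3 (λ x y ν → con 0 :* x :+ ν :* (con 0 :* y) := con 0) refl x y ν

  cross-add-multiple : ∀ m t n → cross (add-multiple m t n) n ≡ cross m n
  cross-add-multiple (a ∷ b ∷ c ∷ []) t (x ∷ y ∷ z ∷ []) =
    vec≡ (entry b y c z) (entry c z a x) (entry a x b y)
    where
    entry : ∀ b y c z → (b + t * y) * z + ν * ((c + t * z) * y) ≡ b * z + ν * (c * y)
    entry b y c z = modulo-1+ν 0# (t * y * z)
      (S.solve 6 (λ b y c z t ν →
        (b :+ t :* y) :* z :+ ν :* ((c :+ t :* z) :* y) :+ (con 1 :+ ν) :* con 0
        := b :* z :+ ν :* (c :* y) :+ (con 1 :+ ν) :* (t :* y :* z)) refl b y c z t ν)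

  -- u × (m × n) = (u · n) m - (u · m) n.
  cross-cross : ∀ m n u → evaluate m u ≡ 0# → evaluate n u ≡ 0# → cross u (cross m n) ≡ 𝟎
  cross-cross (a ∷ b ∷ c ∷ []) (x ∷ y ∷ z ∷ []) (r ∷ s ∷ u ∷ []) mu≡0 nu≡0 =
    vec≡ (entry a b c x y z r s u mu≡0 nu≡0)
      (entry b c a y z x s u r (trans (rotate (b * s) (c * u) (a * r)) mu≡0)
        (trans (rotate (y * s) (z * u) (x * r)) nu≡0))
      (entry c a b z x y u r s (trans (sym (rotate (a * r) (b * s) (c * u))) mu≡0)
        (trans (sym (rotate (x * r) (y * s) (z * u))) nu≡0))
    where
    rotate : ∀ i j k → i + j + k ≡ k + i + j
    rotate i j k = S.solve 3 (λ i j k → i :+ j :+ k := k :+ i :+ j) refl i j k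
    entry : ∀ a b c x y z r s u → a * r + b * s + c * u ≡ 0# → x * r + y * s + z * u ≡ 0# →
            s * (a * y + ν * (b * x)) + ν * (u * (c * x + ν * (a * z))) ≡ 0#
    entry a b c x y z r s u mu≡0 nu≡0 = trans
      (modulo-1+ν (a * x * r + a * z * u) (ν * (u * a * z))
        (S.solve 10 (λ a b c x y z r s u ν →
          s :* (a :* y :+ ν :* (b :* x)) :+ ν :* (u :* (c :* x :+ ν :* (a :* z)))
            :+ (con 1 :+ ν) :* (a :* x :* r :+ a :* z :* u)
          := a :* (x :* r :+ y :* s :+ z :* u) :+ ν :* (x :* (a :* r :+ b :* s :+ c :* u))
            :+ (con 1 :+ ν) :* (ν :* (u :* a :* z))) refl a b c x y z r s u ν))
      (trans (cong₂ (λ v w → a * v + ν * (x * w)) nu≡0 mu≡0)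
        (S.solve 3 (λ a x ν → a :* con 0 :+ ν :* (x :* con 0) := con 0) refl a x ν))

  ratio : ∀ {a b x y} → b ≢ 0# → b * x ≡ a * y → x ≡ a * inv b * y
  ratio {a} {b} {x} {y} b≢0 eq = *-cancelˡ b b≢0 (trans eq (sym (trans
    (S.solve 4 (λ a b i y → b :* (a :* i :* y) := b :* i :* (a :* y)) refl a b (inv b) y)
    (trans (cong (_* (a * y)) (inv-inverse b b≢0)) (*-identityˡ (a * y))))))

  cross≡0⇒proportional : ∀ m n → cross m n ≡ 𝟎 → n ≢ 𝟎 → ∃ λ c → m ≡ Vec.map (c *_) n
  cross≡0⇒proportional (a ∷ b ∷ c ∷ []) (x ∷ y ∷ z ∷ []) eq n≢0
    with bz≡cy ← x+νy≡0⇒x≡y (cong Vec.head eq)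
       | cx≡az ← x+νy≡0⇒x≡y (cong (Vec.head ∘ Vec.tail) eq)
       | ay≡bx ← x+νy≡0⇒x≡y (cong (Vec.head ∘ Vec.tail ∘ Vec.tail) eq)
    with x ≟ᶠ 0# | y ≟ᶠ 0# | z ≟ᶠ 0#
  ... | no x≢0 | _ | _ = a * inv x , vec≡ (ratio x≢0 (*-comm x a))
    (ratio x≢0 (trans (*-comm x b) (sym ay≡bx))) (ratio x≢0 (trans (*-comm x c) cx≡az))
  ... | yes _ | no y≢0 | _ = b * inv y , vec≡ (ratio y≢0 (trans (*-comm y a) ay≡bx))
    (ratio y≢0 (*-comm y b)) (ratio y≢0 (trans (*-comm y c) (sym bz≡cy)))
  ... | yes _ | yes _ | no z≢0 = c * inv z , vec≡ (ratio z≢0 (trans (*-comm z a) (sym cx≡az)))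
    (ratio z≢0 (trans (*-comm z b) bz≡cy)) (ratio z≢0 (*-comm z c))
  ... | yes refl | yes refl | yes refl = contradiction refl n≢0

  scale-0 : ∀ v → Vec.map (0# *_) v ≡ 𝟎
  scale-0 (x ∷ y ∷ z ∷ []) = vec≡ (zeroˡ x) (zeroˡ y) (zeroˡ z)

  Point : Set
  Point = Fin pointCount

  nonvanishing : ∀ v → v ≢ 𝟎 → ∃ λ m → evaluate m v ≢ 0#
  nonvanishing (x ∷ y ∷ z ∷ []) v≢0 with x ≟ᶠ 0# | y ≟ᶠ 0# | z ≟ᶠ 0#
  ... | no x≢0 | _ | _ = (1# ∷ 0# ∷ 0# ∷ []) , λ eq → x≢0 (trans (sym (trans
    (cong₂ _+_ (cong₂ _+_ (*-identityˡ x) (zeroˡ y)) (zeroˡ z))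
    (trans (+-identityʳ _) (+-identityʳ x)))) eq)
  ... | yes _ | no y≢0 | _ = (0# ∷ 1# ∷ 0# ∷ []) , λ eq → y≢0 (trans (sym (trans
    (cong₂ _+_ (cong₂ _+_ (zeroˡ x) (*-identityˡ y)) (zeroˡ z))
    (trans (+-identityʳ _) (+-identityˡ y)))) eq)
  ... | yes _ | yes _ | no z≢0 = (0# ∷ 0# ∷ 1# ∷ []) , λ eq → z≢0 (trans (sym (trans
    (cong₂ _+_ (cong₂ _+_ (zeroˡ x) (zeroˡ y)) (*-identityˡ z))
    (trans (cong (_+ z) (+-identityˡ 0#)) (+-identityˡ z)))) eq)
  ... | yes refl | yes refl | yes refl = contradiction refl v≢0

  coordinates≢0 : ∀ i → coordinates i ≢ 𝟎
  coordinates≢0 i = proj₂ (Inverse.from points i)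

  proportional-points : ∀ {i j} c → coordinates i ≡ Vec.map (c *_) (coordinates j) → i ≡ j
  proportional-points {i} {j} c eq = trans (sym (Inverse.strictlyInverseˡ points i))
    (trans (Inverse.to-cong points {Inverse.from points i} {Inverse.from points j} (c , c≢0 , eq))
      (Inverse.strictlyInverseˡ points j))
    where
    c≢0 : c ≢ 0#
    c≢0 refl = coordinates≢0 i (trans eq (scale-0 (coordinates j)))

  cross≢0⇒≢0 : ∀ m n → cross m n ≢ 𝟎 → m ≢ 𝟎
  cross≢0⇒≢0 m n m×n≢0 refl = m×n≢0 (cross-0ˡ n)

  infix 9 _at_

  -- Opaque, because with-abstraction would otherwise normalise the bijection
  -- between points and indices.
  opaque
    _at_ : Vec Carrier 3 → Point → Carrier
    m at i = evaluate m (coordinates i)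

    locus : Line → PointSet
    locus = pointsOn

    locus≡pointsOn : locus ≡ pointsOn
    locus≡pointsOn = refl

    ∈-locus⁺ : ∀ (ℓ : Line) {i} → proj₁ ℓ at i ≡ 0# → i ∈ˢ locus ℓ
    ∈-locus⁺ ℓ {i} eq = Vec.lookup⇒[]= i _
      (trans (Vec.lookup∘tabulate _ i) (dec-true (proj₁ ℓ at i ≟ᶠ 0#) eq))

    ∈-locus⁻ : ∀ (ℓ : Line) {i} → i ∈ˢ locus ℓ → proj₁ ℓ at i ≡ 0#
    ∈-locus⁻ ℓ {i} i∈ = does-true (proj₁ ℓ at i ≟ᶠ 0#)
      (trans (sym (Vec.lookup∘tabulate _ i)) (Vec.[]=⇒lookup i∈))

    at-add-multiple : ∀ m t n i → add-multiple m t n at i ≡ m at i + t * n at i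
    at-add-multiple m t n i = evaluate-add-multiple m t n (coordinates i)

    at-scale : ∀ c m i → Vec.map (c *_) m at i ≡ c * m at i
    at-scale c m i = evaluate-scaleˡ c m (coordinates i)

    nonvanishing-at : ∀ i → ∃ λ m → m at i ≢ 0#
    nonvanishing-at i = nonvanishing (coordinates i) (coordinates≢0 i)

    common-point : ∀ m n → cross m n ≢ 𝟎 → ∃ λ i → m at i ≡ 0# × n at i ≡ 0#
    common-point m n m×n≢0 = i , vanish m (evaluate-crossˡ m n) , vanish n (evaluate-crossʳ m n)
      where
      i : Point
      i = Inverse.to points (cross m n , m×n≢0)
      vanish : ∀ ℓ → evaluate ℓ (cross m n) ≡ 0# → ℓ at i ≡ 0#
      -- The normalised coordinates of i are a multiple c of the cross product.
      vanish ℓ e with c , _ , eq ← Inverse.strictlyInverseʳ points (cross m n , m×n≢0) =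
        trans (cong (evaluate ℓ) eq)
          (trans (evaluate-scaleʳ c ℓ (cross m n)) (trans (cong (c *_) e) (zeroʳ c)))

    -- Both coordinate vectors are annihilated by m and n, so by `cross-cross` both are multiples of
    -- m × n.
    common-point-unique : ∀ m n → cross m n ≢ 𝟎 → ∀ {i j} → m at i ≡ 0# → n at i ≡ 0# →
                          m at j ≡ 0# → n at j ≡ 0# → i ≡ j
    common-point-unique m n m×n≢0 {i} {j} mi ni mj nj
      with c , ei ← cross≡0⇒proportional _ (cross m n) (cross-cross m n _ mi ni) m×n≢0
         | d , ej ← cross≡0⇒proportional _ (cross m n) (cross-cross m n _ mj nj) m×n≢0 =
      proportional-points (c * inv d)
        (trans ei (trans (rescale (cross m n)) (cong (Vec.map (c * inv d *_)) (sym ej))))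
      where
      d≢0 : d ≢ 0#
      d≢0 refl = coordinates≢0 j (trans ej (scale-0 (cross m n)))
      rescale : (v : Vec Carrier 3) → Vec.map (c *_) v ≡ Vec.map (c * inv d *_) (Vec.map (d *_) v)
      rescale (x ∷ y ∷ z ∷ []) = vec≡ (entry x) (entry y) (entry z)
        where
        entry : ∀ x → c * x ≡ c * inv d * (d * x)
        entry x = sym (trans
          (S.solve 4 (λ c i d x → c :* i :* (d :* x) := d :* i :* (c :* x)) refl c (inv d) d x)
          (trans (cong (_* (c * x)) (inv-inverse d d≢0)) (*-identityˡ _)))

    line-through : ∀ {i j} → i ≢ j → ∃ λ m → m ≢ 𝟎 × m at i ≡ 0# × m at j ≡ 0#
    line-through {i} {j} i≢j = cross (coordinates i) (coordinates j) ,
      (λ eq → let c , e = cross≡0⇒proportional _ _ eq (coordinates≢0 j)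
              in i≢j (proportional-points c e)) ,
      trans (evaluate-comm _ (coordinates i)) (evaluate-crossˡ (coordinates i) (coordinates j)) ,
      trans (evaluate-comm _ (coordinates j)) (evaluate-crossʳ (coordinates i) (coordinates j))

  -- Distinctness of lines is expressed as a nonzero cross product; here and in `separatedˡ` it is
  -- obtained from a point on one line and off the other.
  separatedʳ : ∀ {m n i} → m ≢ 𝟎 → n ≢ 𝟎 → m at i ≡ 0# → n at i ≢ 0# → cross m n ≢ 𝟎
  separatedʳ {m} {n} {i} m≢0 n≢0 mi≡0 ni≢0 m×n≡0
    with c , refl ← cross≡0⇒proportional m n m×n≡0 n≢0 = m≢0 (trans
      (cong (λ d → Vec.map (d *_) n) (integral (n at i) ni≢0
        (trans (*-comm _ c) (trans (sym (at-scale c n i)) mi≡0)))) (scale-0 n))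

  separatedˡ : ∀ {m n i} → n ≢ 𝟎 → m at i ≢ 0# → n at i ≡ 0# → cross m n ≢ 𝟎
  separatedˡ {m} {n} {i} n≢0 mi≢0 ni≡0 m×n≡0
    with c , refl ← cross≡0⇒proportional m n m×n≡0 n≢0 =
      mi≢0 (trans (at-scale c n i) (trans (cong (c *_) ni≡0) (zeroʳ c)))

-- Counting in finite subsets.

members : ∀ {n} → Subset n → List (Fin n)
members []          = []
members (true  ∷ p) = zero ∷ map suc (members p)
members (false ∷ p) = map suc (members p)

length-members : ∀ {n} (p : Subset n) → length (members p) ≡ ∣ p ∣
length-members []          = refl
length-members (true  ∷ p) = cong suc (trans (length-map suc (members p)) (length-members p))
length-members (false ∷ p) = trans (length-map suc (members p)) (length-members p)

∈-members⁺ : ∀ {n} {p : Subset n} {i} → i ∈ˢ p → i ∈ members p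
∈-members⁺                   here       = here refl
∈-members⁺ {p = true  ∷ _}  (there i∈) = there (∈-map⁺ suc (∈-members⁺ i∈))
∈-members⁺ {p = false ∷ _}  (there i∈) = ∈-map⁺ suc (∈-members⁺ i∈)

∈-members⁻ : ∀ {n} {p : Subset n} {i} → i ∈ members p → i ∈ˢ p
∈-members⁻ {p = true ∷ _}  (here refl) = here
∈-members⁻ {p = true ∷ _}  (there i∈) with _ , j∈ , refl ← ∈-map⁻ suc i∈ = there (∈-members⁻ j∈)
∈-members⁻ {p = false ∷ _} i∈         with _ , j∈ , refl ← ∈-map⁻ suc i∈ = there (∈-members⁻ j∈)

members-unique : ∀ {n} (p : Subset n) → Unique (members p)
members-unique []          = []
members-unique (true  ∷ p) = All.tabulate (λ i∈ → λ { refl → zero∉ i∈ }) ∷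
  Unique.map⁺ Fin.suc-injective (members-unique p)
  where
  zero∉ : zero ∉ map suc (members p)
  zero∉ i∈ with _ , _ , () ← ∈-map⁻ suc i∈
members-unique (false ∷ p) = Unique.map⁺ Fin.suc-injective (members-unique p)

-- For a line M, the set B and the line L this separates the points of M ∩ B in U from the one
-- possible point on L.
∣p∩q∣-split : ∀ {n} (p q r : Subset n) →
              ∣ p ∩ q ∣ ≡ ∣ p ∩ (q ∩ ∁ r) ∣ ℕ.+ ∣ (p ∩ r) ∩ q ∣
∣p∩q∣-split []          []          []          = refl
∣p∩q∣-split (false ∷ p) (_     ∷ q) (_     ∷ r) = ∣p∩q∣-split p q r
∣p∩q∣-split (true  ∷ p) (false ∷ q) (false ∷ r) = ∣p∩q∣-split p q r
∣p∩q∣-split (true  ∷ p) (false ∷ q) (true  ∷ r) = ∣p∩q∣-split p q r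
∣p∩q∣-split (true  ∷ p) (true  ∷ q) (false ∷ r) = cong suc (∣p∩q∣-split p q r)
∣p∩q∣-split (true  ∷ p) (true  ∷ q) (true  ∷ r) =
  trans (cong suc (∣p∩q∣-split p q r)) (sym (ℕ.+-suc _ _))

∣p∣-split : ∀ {n} (p q : Subset n) → ∣ p ∣ ≡ ∣ p ∩ ∁ q ∣ ℕ.+ ∣ q ∩ p ∣
∣p∣-split []          []          = refl
∣p∣-split (false ∷ p) (false ∷ q) = ∣p∣-split p q
∣p∣-split (false ∷ p) (true  ∷ q) = ∣p∣-split p q
∣p∣-split (true  ∷ p) (false ∷ q) = cong suc (∣p∣-split p q)
∣p∣-split (true  ∷ p) (true  ∷ q) = trans (cong suc (∣p∣-split p q)) (sym (ℕ.+-suc _ _))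

unique-map-on : ∀ {A B : Set} (f : A → B) {xs : List A} → Unique xs →
                (∀ {x y} → x ∈ xs → y ∈ xs → f x ≡ f y → x ≡ y) → Unique (map f xs)
unique-map-on f []        inj = []
unique-map-on f {x ∷ xs} (x∉ ∷ u) inj = All.tabulate (λ z∈ eq → fresh z∈ eq) ∷
  unique-map-on f u (λ x∈ y∈ → inj (there x∈) (there y∈))
  where
  fresh : ∀ {z} → z ∈ map f xs → f x ≢ z
  fresh z∈ eq with y , y∈ , refl ← ∈-map⁻ f z∈ =
    All.lookup x∉ y∈ (inj (here refl) (there y∈) eq)

module Zeros {q : ℕ} (F : FiniteField q) where
  open FiniteField F
  open Series F

  zeros-none : ∀ {cs} → 0# ∉ cs → zeros cs ≡ 0
  zeros-none {[]}     0∉ = refl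
  zeros-none {c ∷ cs} 0∉ with c ≟ᶠ 0#
  ... | yes c≡0 = contradiction (here (sym c≡0)) 0∉
  ... | no  _   = zeros-none (0∉ ∘ there)

  zeros-all : ∀ {cs} → (∀ {c} → c ∈ cs → c ≡ 0#) → zeros cs ≡ length cs
  zeros-all {[]}     all = refl
  zeros-all {c ∷ cs} all with c ≟ᶠ 0#
  ... | yes _  = cong suc (zeros-all (all ∘ there))
  ... | no c≢0 = contradiction (all (here refl)) c≢0

  zeros-unique : ∀ {cs} → Unique cs → 0# ∈ cs → zeros cs ≡ 1
  zeros-unique {c ∷ cs} (c∉ ∷ u) 0∈ with c ≟ᶠ 0# | 0∈
  ... | yes refl | _         = cong suc (zeros-none λ 0∈ → All.lookup c∉ 0∈ refl)
  ... | no c≢0   | here refl = contradiction refl c≢0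
  ... | no _     | there 0∈  = zeros-unique u 0∈

  zeros-map-members : ∀ {n} (f : Fin n → Carrier) (p u : Subset n) →
                      (∀ {i} → i ∈ˢ u → f i ≡ 0# → i ∈ˢ p) →
                      (∀ {i} → i ∈ˢ u → i ∈ˢ p → f i ≡ 0#) →
                      zeros (map f (members u)) ≡ ∣ p ∩ u ∣
  zeros-map-members f []      []          to from = refl
  zeros-map-members f (x ∷ p) (y ∷ u) to from
    with ih ← trans (cong zeros (sym (map-∘ {g = f} {f = suc} (members u))))
                (zeros-map-members (f ∘ suc) p u
                  (λ i∈ e → drop-there (to (there i∈) e)) (λ i∈ j∈ → from (there i∈) (there j∈)))
    with y | x
  ... | false | false = ih
  ... | false | true  = ih
  ... | true  | x     with f zero ≟ᶠ 0# | x
  ...   | yes _    | true  = cong suc ih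
  ...   | yes f0≡0 | false = contradiction (to here f0≡0) λ ()
  ...   | no  f0≢0 | true  = contradiction (from here here) f0≢0
  ...   | no  _    | false = ih

unique-⊆⇒length≤ : ∀ {A : Set} {xs ys : List A} → Unique xs → (∀ {x} → x ∈ xs → x ∈ ys) →
                   length xs ≤ length ys
unique-⊆⇒length≤ {xs = xs} {ys} u sub with ℕ.≤-total (length xs) (length ys)
... | inj₁ le = le
... | inj₂ ge = ℕ.≤-reflexive (↭-length (unique-⊆⇒↭ u sub ge))

∣p∣≡1 : ∀ {n} {p : Subset n} {x} → x ∈ˢ p → (∀ {y} → y ∈ˢ p → y ≡ x) → ∣ p ∣ ≡ 1
∣p∣≡1 {p = p} {x} x∈p only = trans (cong ∣_∣ p≡⁅x⁆) (∣⁅x⁆∣≡1 x)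
  where
  p≡⁅x⁆ : p ≡ ⁅ x ⁆
  p≡⁅x⁆ = ⊆-antisym (λ y∈p → subst (_∈ˢ ⁅ x ⁆) (sym (only y∈p)) (x∈⁅x⁆ x))
    (λ y∈ → subst (_∈ˢ p) (sym (x∈⁅y⁆⇒x≡y x y∈)) x∈p)

∣p∣≡0 : ∀ {n} {p : Subset n} → (∀ {x} → x ∉ˢ p) → ∣ p ∣ ≡ 0
∣p∣≡0 {n} none = trans (cong ∣_∣ (Empty-unique λ (_ , x∈p) → none x∈p)) (∣⊥∣≡0 n)

-- One exceptional point x, and a bijection f from the rest of p to `ys`. It is made for a
-- projective line with an affine parameter f that has no meaning at its point x at infinity.
∣p∣≡length+1 : ∀ {n} {A : Set} {p : Subset n} {x} (f : Fin n → A) {ys : List A} →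
  x ∈ˢ p → Unique ys → (∀ {z} → z ∈ˢ p → z ≢ x → f z ∈ ys) →
  (∀ {z w} → z ∈ˢ p → z ≢ x → w ∈ˢ p → w ≢ x → f z ≡ f w → z ≡ w) →
  (∀ {y} → y ∈ ys → ∃ λ z → z ∈ˢ p × z ≢ x × f z ≡ y) →
  ∣ p ∣ ≡ length ys ℕ.+ 1
∣p∣≡length+1 {p = p} {x} f {ys} x∈p ys! into injective onto =
  trans (∣p∣-split p ⁅ x ⁆) (cong₂ ℕ._+_ rest
    (∣p∣≡1 (x∈p∩q⁺ (x∈⁅x⁆ x , x∈p)) λ z∈ → x∈⁅y⁆⇒x≡y x (proj₁ (x∈p∩q⁻ ⁅ x ⁆ p z∈))))
  where
  p∖x = p ∩ ∁ ⁅ x ⁆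
  off-x : ∀ {z} → z ∈ members p∖x → z ∈ˢ p × z ≢ x
  off-x z∈ with z∈p , z∉x ← x∈p∩q⁻ p (∁ ⁅ x ⁆) (∈-members⁻ z∈) =
    z∈p , λ { refl → x∈∁p⇒x∉p z∉x (x∈⁅x⁆ _) }
  image⊆ys : ∀ {y} → y ∈ map f (members p∖x) → y ∈ ys
  image⊆ys y∈ with z , z∈ , refl ← ∈-map⁻ f y∈ = into (proj₁ (off-x z∈)) (proj₂ (off-x z∈))
  ys⊆image : ∀ {y} → y ∈ ys → y ∈ map f (members p∖x)
  ys⊆image y∈ with z , z∈p , z≢x , refl ← onto y∈ =
    ∈-map⁺ f (∈-members⁺ (x∈p∩q⁺ (z∈p , x∉p⇒x∈∁p (z≢x ∘ x∈⁅y⁆⇒x≡y x))))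
  image-unique : Unique (map f (members p∖x))
  image-unique = unique-map-on f (members-unique p∖x) λ z∈ w∈ →
    injective (proj₁ (off-x z∈)) (proj₂ (off-x z∈)) (proj₁ (off-x w∈)) (proj₂ (off-x w∈))
  rest : ∣ p∖x ∣ ≡ length ys
  rest = trans (sym (trans (length-map f (members p∖x)) (length-members p∖x)))
    (ℕ.≤-antisym (unique-⊆⇒length≤ image-unique image⊆ys) (unique-⊆⇒length≤ ys! ys⊆image))

-- Intersections and sizes of lines, pencils.

module Lines {q : ℕ} (F : FiniteField q) where
  open FiniteField F
  open FieldProperties F
  open ProjectivePlane F
  open Geometry F
  open S using (_:+_; _:*_; _:=_)

  ∣m∩n∣≡1 : (M N : Line) → cross (proj₁ M) (proj₁ N) ≢ 𝟎 → ∣ locus M ∩ locus N ∣ ≡ 1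
  ∣m∩n∣≡1 M N ind with i , mi , ni ← common-point (proj₁ M) (proj₁ N) ind =
    ∣p∣≡1 (x∈p∩q⁺ (∈-locus⁺ M mi , ∈-locus⁺ N ni)) λ j∈ →
      let j∈M , j∈N = x∈p∩q⁻ _ _ j∈
      in common-point-unique (proj₁ M) (proj₁ N) ind (∈-locus⁻ M j∈M) (∈-locus⁻ N j∈N) mi ni

  proportional-locus : (M N : Line) → cross (proj₁ M) (proj₁ N) ≡ 𝟎 →
                          locus M ≡ locus N
  proportional-locus M N@(n , n≢0) dep
    with c , refl ← cross≡0⇒proportional (proj₁ M) n dep n≢0 = ⊆-antisym
      (λ i∈ → ∈-locus⁺ N (integral c c≢0
        (trans (sym (at-scale c n _)) (∈-locus⁻ M i∈))))
      (λ i∈ → ∈-locus⁺ M (trans (at-scale c n _)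
        (trans (cong (c *_) (∈-locus⁻ N i∈)) (zeroʳ c))))
    where
    c≢0 : c ≢ 0#
    c≢0 refl = proj₂ M (scale-0 n)

  -- The forms m + t n cut out on the line ℓ all points other than ∞; τ z is the value of t
  -- for the point z.
  module Pencil (ℓ m n : Vec Carrier 3) (∞ : Point) (ℓ≢0 : ℓ ≢ 𝟎) (n×ℓ≢0 : cross n ℓ ≢ 𝟎)
                (ℓ∞≡0 : ℓ at ∞ ≡ 0#) (n∞≡0 : n at ∞ ≡ 0#) (m∞≢0 : m at ∞ ≢ 0#) where

    member : Carrier → Vec Carrier 3
    member t = add-multiple m t n

    τ : Point → Carrier
    τ z = ν * (m at z * inv (n at z))

    member-∞ : ∀ t → member t at ∞ ≢ 0#
    member-∞ t eq = m∞≢0 (trans (sym (+-identityʳ _)) (trans (cong (m at ∞ +_)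
      (sym (trans (cong (t *_) n∞≡0) (zeroʳ t)))) (trans (sym (at-add-multiple m t n ∞)) eq)))

    member-independent : ∀ t → cross (member t) ℓ ≢ 𝟎
    member-independent t = separatedˡ ℓ≢0 (member-∞ t) ℓ∞≡0

    n≢0-off-∞ : ∀ {z} → ℓ at z ≡ 0# → z ≢ ∞ → n at z ≢ 0#
    n≢0-off-∞ ℓz≡0 z≢∞ nz≡0 = z≢∞ (common-point-unique n ℓ n×ℓ≢0 nz≡0 ℓz≡0 n∞≡0 ℓ∞≡0)

    member-τ : ∀ {z} → n at z ≢ 0# → member (τ z) at z ≡ 0#
    member-τ {z} nz≢0 = trans (at-add-multiple m (τ z) n z) (trans
      (S.solve 4 (λ x y i ν → x :+ ν :* (x :* i) :* y := x :+ ν :* (x :* (y :* i))) refl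
        (m at z) (n at z) (inv (n at z)) ν)
      (trans (cong (λ w → m at z + ν * (m at z * w)) (inv-inverse (n at z) nz≢0))
        (trans (cong (λ w → m at z + ν * w) (*-identityʳ (m at z))) (x+νx≡0 (m at z)))))

    τ-injective : ∀ {z w} → ℓ at z ≡ 0# → z ≢ ∞ → ℓ at w ≡ 0# → w ≢ ∞ → τ z ≡ τ w → z ≡ w
    τ-injective {z} {w} ℓz z≢∞ ℓw w≢∞ eq = common-point-unique (member (τ z)) ℓ
      (member-independent (τ z)) (member-τ (n≢0-off-∞ ℓz z≢∞)) ℓz
      (trans (cong (λ t → member t at w) eq) (member-τ (n≢0-off-∞ ℓw w≢∞))) ℓw

    τ-surjective : ∀ t → ∃ λ z → ℓ at z ≡ 0# × z ≢ ∞ × τ z ≡ t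
    τ-surjective t with z , mz , ℓz ← common-point (member t) ℓ (member-independent t) =
      z , ℓz , z≢∞ , *-cancelˡ (n at z) nz≢0 (trans (*-comm _ _) (trans
        (+-cancelˡ (m at z) (trans (sym (at-add-multiple m (τ z) n z))
          (trans (member-τ nz≢0) (trans (sym mz) (at-add-multiple m t n z))))) (*-comm _ _)))
      where
      z≢∞ : z ≢ ∞
      z≢∞ refl = member-∞ t mz
      nz≢0 : n at z ≢ 0#
      nz≢0 = n≢0-off-∞ ℓz z≢∞

    line-size : ∣ locus (ℓ , ℓ≢0) ∣ ≡ q ℕ.+ 1
    line-size = trans (∣p∣≡length+1 τ (∈-locus⁺ (ℓ , ℓ≢0) ℓ∞≡0) elements-unique
      (λ {x} _ _ → ∈-elements (τ x))
      (λ z∈ z≢∞ w∈ w≢∞ → τ-injective (∈-locus⁻ (ℓ , ℓ≢0) z∈) z≢∞ (∈-locus⁻ (ℓ , ℓ≢0) w∈) w≢∞)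
      (λ {t} _ → let z , ℓz , z≢∞ , τz≡t = τ-surjective t
                 in z , ∈-locus⁺ (ℓ , ℓ≢0) ℓz , z≢∞ , τz≡t))
      (cong (ℕ._+ 1) length-elements)

  -- The point z serves as ∞. Joining it to u off the line gives an n independent of ℓ, and any form
  -- that is nonzero at z serves as m.
  ∣line∣≡q+1 : (M : Line) → ∀ {z u} → proj₁ M at z ≡ 0# → proj₁ M at u ≢ 0# →
               ∣ locus M ∣ ≡ q ℕ.+ 1
  ∣line∣≡q+1 (ℓ , ℓ≢0) {z} {u} ℓz≡0 ℓu≢0
    with n , n≢0 , nz≡0 , nu≡0 ← line-through {z} {u} (λ { refl → ℓu≢0 ℓz≡0 }) =
    Pencil.line-size ℓ (proj₁ (nonvanishing-at z)) n z ℓ≢0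
      (separatedʳ n≢0 ℓ≢0 nu≡0 ℓu≢0) ℓz≡0 nz≡0 (proj₂ (nonvanishing-at z))

-- Lines other than L meet B in 1 modulo p points.

-- For r = q + 1 - k the inequality q ≤ 2 r says exactly 2 k ≤ q + 2; this is the origin of the
-- bound on k.
complement-large : ∀ {q r k} → q ℕ.+ 1 ≡ r ℕ.+ k → 2 ℕ.* k < q ℕ.+ 3 → q ≤ r ℕ.+ r
complement-large {q} {r} {k} q+1≡r+k 2k<q+3 = ℕ.+-cancelʳ-≤ (q ℕ.+ 3) q (r ℕ.+ r) (begin
  q ℕ.+ (q ℕ.+ 3)                   ≡⟨ solve 1 (λ q →
    q :+ (q :+ con 3) := con 1 :+ ((q :+ con 1) :+ (q :+ con 1))) refl q ⟩
  1 ℕ.+ ((q ℕ.+ 1) ℕ.+ (q ℕ.+ 1))   ≡⟨ cong (λ s → 1 ℕ.+ (s ℕ.+ s)) q+1≡r+k ⟩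
  1 ℕ.+ ((r ℕ.+ k) ℕ.+ (r ℕ.+ k))   ≡⟨ solve 2 (λ r k →
    con 1 :+ ((r :+ k) :+ (r :+ k)) := (r :+ r) :+ (con 1 :+ con 2 :* k)) refl r k ⟩
  (r ℕ.+ r) ℕ.+ (1 ℕ.+ 2 ℕ.* k)     ≤⟨ ℕ.+-monoʳ-≤ (r ℕ.+ r) 2k<q+3 ⟩
  (r ℕ.+ r) ℕ.+ (q ℕ.+ 3)           ∎)
  where
  open ℕ.≤-Reasoning
  open +-*-Solver using (solve; _:+_; _:*_; _:=_; con)

module Secant {q : ℕ} (F : FiniteField q) where
  open FiniteField F
  open FieldProperties F
  open ProjectivePlane F
  open Geometry F
  open Lines F
  open Series F
  open Zeros F
  open Lacunary F
  open S using (_:+_; _:*_; _:=_; con)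

  module _
    (p k : ℕ) (p-prime : Prime p) (ιp≡0 : ι p ≡ 0#)
    (B : PointSet)
    (blocks : ∀ m → m ≢ 𝟎 → ∃ λ b → m at b ≡ 0# × b ∈ˢ B)
    (essential : ∀ {y} → y ∈ˢ B → ¬ (∀ m → m ≢ 𝟎 → ∃ λ b → m at b ≡ 0# × b ∈ˢ B × b ≢ y))
    (∣B∣≡q+k : ∣ B ∣ ≡ q ℕ.+ k) (2k<q+3 : 2 ℕ.* k < q ℕ.+ 3)
    (ℓ : Vec Carrier 3) (ℓ≢0 : ℓ ≢ 𝟎)
    (∣ℓ∩B∣≡k : ∣ locus (ℓ , ℓ≢0) ∩ B ∣ ≡ k)
    where

    on U : PointSet
    on = locus (ℓ , ℓ≢0)
    U  = B ∩ ∁ on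

    us : List Point
    us = members U

    ∈us⁺ : ∀ {u} → u ∈ˢ B → ℓ at u ≢ 0# → u ∈ us
    ∈us⁺ u∈B ℓu≢0 = ∈-members⁺ {p = U}
      (x∈p∩q⁺ {p = B} {q = ∁ on} (u∈B , x∉p⇒x∈∁p (ℓu≢0 ∘ ∈-locus⁻ (ℓ , ℓ≢0))))

    ∈U⇒off : ∀ {u} → u ∈ˢ U → ℓ at u ≢ 0#
    ∈U⇒off u∈U ℓu≡0 = x∈∁p⇒x∉p (proj₂ (x∈p∩q⁻ B (∁ on) u∈U)) (∈-locus⁺ (ℓ , ℓ≢0) ℓu≡0)

    ∈us⇒off : ∀ {u} → u ∈ us → ℓ at u ≢ 0#
    ∈us⇒off u∈us = ∈U⇒off (∈-members⁻ {p = U} u∈us)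

    ∈us⇒∈B : ∀ {u} → u ∈ us → u ∈ˢ B
    ∈us⇒∈B u∈us = proj₁ (x∈p∩q⁻ B (∁ on) (∈-members⁻ {p = U} u∈us))

    length-us : length us ≡ q
    length-us = trans (length-members U) (ℕ.+-cancelʳ-≡ k ∣ U ∣ q
      (trans (cong (∣ U ∣ ℕ.+_) (sym ∣ℓ∩B∣≡k)) (trans (sym (∣p∣-split B on)) ∣B∣≡q+k)))

    coordinate : Vec Carrier 3 → Point → Carrier
    coordinate m u = m at u * inv (ℓ at u)

    coordinate⁻ : ∀ m {u x} → ℓ at u ≢ 0# → coordinate m u ≡ x → m at u ≡ x * ℓ at u
    coordinate⁻ m {u} ℓu≢0 refl = sym (trans
      (S.solve 3 (λ a b c → a :* b :* c := c :* b :* a) refl (m at u) (inv (ℓ at u)) (ℓ at u))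
      (trans (cong (_* m at u) (inv-inverse (ℓ at u) ℓu≢0)) (*-identityˡ (m at u))))

    coordinate⁺ : ∀ m {u x} → ℓ at u ≢ 0# → m at u ≡ x * ℓ at u → coordinate m u ≡ x
    coordinate⁺ m {u} {x} ℓu≢0 eq = trans (cong (_* inv (ℓ at u)) eq)
      (trans (*-assoc x (ℓ at u) (inv (ℓ at u)))
        (trans (cong (x *_) (inv-inverse (ℓ at u) ℓu≢0)) (*-identityʳ x)))

    coordinate≡0⁻ : ∀ m {u} → ℓ at u ≢ 0# → coordinate m u ≡ 0# → m at u ≡ 0#
    coordinate≡0⁻ m ℓu≢0 eq = trans (coordinate⁻ m ℓu≢0 eq) (zeroˡ _)

    coordinate≡0⁺ : ∀ m {u} → m at u ≡ 0# → coordinate m u ≡ 0#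
    coordinate≡0⁺ m {u} eq = trans (cong (_* inv (ℓ at u)) eq) (zeroˡ _)

    slopes : Vec Carrier 3 → List Carrier
    slopes m = map (coordinate m) us

    length-slopes : ∀ m → length (slopes m) ≡ q
    length-slopes m = trans (length-map (coordinate m) us) length-us

    zeros-slopes : (M : Line) → zeros (slopes (proj₁ M)) ≡ ∣ locus M ∩ U ∣
    zeros-slopes M = zeros-map-members (coordinate (proj₁ M)) (locus M) U
      (λ u∈U eq → ∈-locus⁺ M (coordinate≡0⁻ (proj₁ M) (∈U⇒off u∈U) eq))
      (λ u∈U u∈M → coordinate≡0⁺ (proj₁ M) (∈-locus⁻ M u∈M))

    -- The lines through z ∉ B other than ℓ are m - x ℓ, and each of them meets B off ℓ.
    slopes-covering : ∀ {m z} → cross m ℓ ≢ 𝟎 → m at z ≡ 0# → ℓ at z ≡ 0# → z ∉ˢ B →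
                      ∀ x → x ∈ slopes m
    slopes-covering {m} {z} m×ℓ≢0 mz≡0 ℓz≡0 z∉B x
      with b , m′b≡0 , b∈B ← blocks (add-multiple m (ν * x) ℓ)
             (cross≢0⇒≢0 _ ℓ (m×ℓ≢0 ∘ trans (sym (cross-add-multiple m (ν * x) ℓ)))) =
      subst (_∈ slopes m) (coordinate⁺ m ℓb≢0 mb≡xℓb) (∈-map⁺ (coordinate m) (∈us⁺ b∈B ℓb≢0))
      where
      mb≡xℓb : m at b ≡ x * ℓ at b
      mb≡xℓb = x+νy≡0⇒x≡y (trans (cong (m at b +_) (sym (*-assoc ν x (ℓ at b))))
        (trans (sym (at-add-multiple m (ν * x) ℓ b)) m′b≡0))
      ℓb≢0 : ℓ at b ≢ 0#
      ℓb≢0 ℓb≡0 = z∉B (subst (_∈ˢ B) (common-point-unique m ℓ m×ℓ≢0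
        (trans mb≡xℓb (trans (cong (x *_) ℓb≡0) (zeroʳ x))) ℓb≡0 mz≡0 ℓz≡0) b∈B)

    slopes-unique : ∀ {m} → (∀ x → x ∈ slopes m) → Unique (slopes m)
    slopes-unique {m} covering =
      unique-↭ (covering⇒↭ (slopes m) covering (length-slopes m)) elements-unique

    -- U has q points, and q is positive because the field contains `0#`.
    some-u : ∃ λ u → u ∈ us
    some-u with us | length-us
    ... | []    | eq = contradiction (trans (length-others 0#) (sym eq)) λ ()
    ... | u ∷ _ | _  = u , here refl

    module _ (M : Line) (m×ℓ≢0 : cross (proj₁ M) ℓ ≢ 𝟎) where
      private
        m : Vec Carrier 3
        m = proj₁ M

      module _ {y : Point} (my≡0 : m at y ≡ 0#) (ℓy≡0 : ℓ at y ≡ 0#) (y∈B : y ∈ˢ B) where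

        -- If y is the only point of B on ℓ, then U ∪ {y} is a line.
        zeros-tangent : (∀ z → ℓ at z ≡ 0# → z ∈ˢ B → z ≡ y) → p ∣ zeros (slopes m)
        zeros-tangent only with any? (_≟ᶠ 0#) (slopes m)
        ... | no none = subst (p ∣_)
          (sym (zeros-none λ 0∈ → none (Any.map sym 0∈))) (p ∣0)
        ... | yes some
          with c , c∈ , c≡0 ← find some
          with u , u∈ , refl ← ∈-map⁻ (coordinate m) c∈ =
          subst (p ∣_) (sym (trans (zeros-all all) (length-slopes m)))
            (ι≡0⇒∣ p-prime ιp≡0 q ι-order)
          where
          mu≡0 : m at u ≡ 0#
          mu≡0 = coordinate≡0⁻ m (∈us⇒off u∈) c≡0
          -- Let the line l through u and v meet ℓ in z. If z ∈ B, then z = y, and m and l share the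
          -- distinct points y and u although v is on l only. If z ∉ B, the values of l on U are
          -- distinct, yet vanish at both u and v.
          impossible : ∀ {v} → v ∈ us → ¬ (m at v ≢ 0#)
          impossible {v} v∈ mv≢0
            with l , l≢0 , lu≡0 , lv≡0 ← line-through {u} {v} (λ { refl → mv≢0 mu≡0 })
            with l×ℓ≢0 ← separatedʳ l≢0 ℓ≢0 lu≡0 (∈us⇒off u∈)
            with z , lz≡0 , ℓz≡0 ← common-point l ℓ l×ℓ≢0
            with z ∈? B
          ... | yes z∈B = ∈us⇒off u∈ (subst (λ i → ℓ at i ≡ 0#)
            (common-point-unique m l (separatedˡ l≢0 mv≢0 lv≡0) my≡0
              (subst (λ i → l at i ≡ 0#) (only z ℓz≡0 z∈B) lz≡0) mu≡0 lu≡0) ℓy≡0)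
          ... | no z∉B = mv≢0 (subst (λ i → m at i ≡ 0#)
            (unique-map⇒injective (coordinate l)
              (slopes-unique (slopes-covering l×ℓ≢0 lz≡0 ℓz≡0 z∉B)) u∈ v∈
              (trans (coordinate≡0⁺ l lu≡0) (sym (coordinate≡0⁺ l lv≡0)))) mu≡0)
          all : ∀ {c} → c ∈ slopes m → c ≡ 0#
          all c∈ with v , v∈ , refl ← ∈-map⁻ (coordinate m) c∈ =
            coordinate≡0⁺ m (decidable-stable (m at v ≟ᶠ 0#) (impossible v∈))

        module _ {∞ : Point} (ℓ∞≡0 : ℓ at ∞ ≡ 0#) (∞∈B : ∞ ∈ˢ B) (∞≢y : ∞ ≢ y) where
          private
            m∞≢0 : m at ∞ ≢ 0#
            m∞≢0 m∞≡0 = ∞≢y (common-point-unique m ℓ m×ℓ≢0 m∞≡0 ℓ∞≡0 my≡0 ℓy≡0)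

          -- Every line through y is α m + β ℓ.
          covering⇒inessential : (∀ x → x ∈ slopes m) →
            ∀ f → f ≢ 𝟎 → ∃ λ b → f at b ≡ 0# × b ∈ˢ B × b ≢ y
          covering⇒inessential covering f f≢0 with blocks f f≢0
          ... | b , fb≡0 , b∈B with b Fin.≟ y
          ...   | no b≢y = b , fb≡0 , b∈B , b≢y
          ...   | yes refl with Vec.≡-dec _≟ᶠ_ (cross f ℓ) 𝟎
          -- Here f is ℓ, which no point of U can block; the second point ∞ of B on ℓ does.
          ...     | yes f×ℓ≡0 with c , refl ← cross≡0⇒proportional f ℓ f×ℓ≡0 ℓ≢0 =
            ∞ , trans (at-scale c ℓ ∞) (trans (cong (c *_) ℓ∞≡0) (zeroʳ c)) , ∞∈B , ∞≢y
          ...     | no f×ℓ≢0 = combine (Vec.≡-dec _≟ᶠ_ (cross g ℓ) 𝟎)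
            where
            -- Chosen so that g = f - α m vanishes at ∞. It vanishes at y too, so it has two points
            -- in common with ℓ and is a multiple β ℓ.
            α : Carrier
            α = f at ∞ * inv (m at ∞)
            αm∞≡f∞ : α * m at ∞ ≡ f at ∞
            αm∞≡f∞ = trans (S.solve 3 (λ a b c → a :* b :* c := c :* b :* a) refl
              (f at ∞) (inv (m at ∞)) (m at ∞))
              (trans (cong (_* f at ∞) (inv-inverse (m at ∞) m∞≢0)) (*-identityˡ _))
            α≢0 : α ≢ 0#
            α≢0 α≡0 = ∞≢y (common-point-unique f ℓ f×ℓ≢0
              (trans (sym αm∞≡f∞) (trans (cong (_* m at ∞) α≡0) (zeroˡ _))) ℓ∞≡0 fb≡0 ℓy≡0)
            g : Vec Carrier 3
            g = add-multiple f (ν * α) m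
            g-at : ∀ i → g at i ≡ f at i + ν * (α * m at i)
            g-at i = trans (at-add-multiple f (ν * α) m i)
              (cong (f at i +_) (*-assoc ν α (m at i)))
            g∞≡0 : g at ∞ ≡ 0#
            g∞≡0 = trans (g-at ∞) (trans (cong (λ x → f at ∞ + ν * x) αm∞≡f∞) (x+νx≡0 _))
            gy≡0 : g at b ≡ 0#
            gy≡0 = trans (g-at b) (trans (cong₂ (λ x z → x + ν * (α * z)) fb≡0 my≡0)
              (S.solve 2 (λ ν α → con 0 :+ ν :* (α :* con 0) := con 0) refl ν α))
            combine : Dec (cross g ℓ ≡ 𝟎) → ∃ λ b′ → f at b′ ≡ 0# × b′ ∈ˢ B × b′ ≢ b
            combine (no g×ℓ≢0) =
              contradiction (common-point-unique g ℓ g×ℓ≢0 g∞≡0 ℓ∞≡0 gy≡0 ℓy≡0) ∞≢y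
            combine (yes g×ℓ≡0)
              with β , g≡βℓ ← cross≡0⇒proportional g ℓ g×ℓ≡0 ℓ≢0
              -- f = α m + β ℓ vanishes where m / ℓ takes the value - β / α, and `covering` provides
              -- such a point of U.
              with u , u∈ , xu ← ∈-map⁻ (coordinate m) (covering (ν * (β * inv α))) =
              u , fu≡0 , ∈us⇒∈B u∈ , λ { refl → ∈us⇒off u∈ ℓy≡0 }
              where
              open ≡-Reasoning
              mu : m at u ≡ ν * (β * inv α) * ℓ at u
              mu = coordinate⁻ m (∈us⇒off u∈) (sym xu)
              αmu : α * m at u ≡ ν * (β * ℓ at u)
              αmu = begin
                α * m at u
                  ≡⟨ cong (α *_) mu ⟩
                α * (ν * (β * inv α) * ℓ at u)
                  ≡⟨ S.solve 5 (λ a v b i l → a :* (v :* (b :* i) :* l)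
                       := a :* i :* (v :* (b :* l))) refl α ν β (inv α) (ℓ at u) ⟩
                α * inv α * (ν * (β * ℓ at u))
                  ≡⟨ trans (cong (_* (ν * (β * ℓ at u))) (inv-inverse α α≢0)) (*-identityˡ _) ⟩
                ν * (β * ℓ at u) ∎
              gu : f at u + ν * (α * m at u) ≡ β * ℓ at u
              gu = trans (sym (g-at u)) (trans (cong (_at u) g≡βℓ) (at-scale β ℓ u))
              fu≡0 : f at u ≡ 0#
              fu≡0 = +-cancelʳ (ν * (α * m at u)) (begin
                f at u + ν * (α * m at u)             ≡⟨ gu ⟩
                β * ℓ at u                            ≡⟨ modulo-1+ν (ν * (β * ℓ at u)) (β * ℓ at u) (S.solve 2
                  (λ x v → x :+ (con 1 :+ v) :* (v :* x)
                    := con 0 :+ v :* (v :* x) :+ (con 1 :+ v) :* x) refl (β * ℓ at u) ν) ⟩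
                0# + ν * (ν * (β * ℓ at u))           ≡⟨ cong (λ z → 0# + ν * z) αmu ⟨
                0# + ν * (α * m at u)                 ∎)

          outside : List Point
          outside = members (on ∩ ∁ B)

          r : ℕ
          r = length outside

          2≤k : 2 ≤ k
          2≤k = subst (2 ≤_) (trans (length-members (on ∩ B)) ∣ℓ∩B∣≡k)
            (unique-⊆⇒length≤ {xs = ∞ ∷ y ∷ []} ((∞≢y ∷ []) ∷ [] ∷ []) λ
              { (here refl) → ∈-members⁺ {p = on ∩ B}
                  (x∈p∩q⁺ {p = on} {q = B} (∈-locus⁺ (ℓ , ℓ≢0) ℓ∞≡0 , ∞∈B))
              ; (there (here refl)) → ∈-members⁺ {p = on ∩ B}
                  (x∈p∩q⁺ {p = on} {q = B} (∈-locus⁺ (ℓ , ℓ≢0) ℓy≡0 , y∈B)) })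

          q+1≡r+k : q ℕ.+ 1 ≡ r ℕ.+ k
          q+1≡r+k = trans (sym (∣line∣≡q+1 (ℓ , ℓ≢0) ℓ∞≡0 (∈us⇒off (proj₂ some-u))))
            (trans (∣p∣-split on B) (cong₂ ℕ._+_ (sym (length-members (on ∩ ∁ B)))
              (trans (cong ∣_∣ (∩-comm B on)) ∣ℓ∩B∣≡k)))

          -- Owing to k ≥ 2, every j < r satisfies j < q - 1, the range of `e-elements`.
          r<q : r < q
          r<q = ℕ.+-cancelʳ-≤ 1 (suc r) q (begin
            suc r ℕ.+ 1     ≡⟨ ℕ.+-suc r 1 ⟨
            r ℕ.+ 2         ≤⟨ ℕ.+-monoʳ-≤ r 2≤k ⟩
            r ℕ.+ k         ≡⟨ q+1≡r+k ⟨
            q ℕ.+ 1         ∎)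
            where open ℕ.≤-Reasoning

          outside⁻ : ∀ {z} → z ∈ outside → ℓ at z ≡ 0# × z ∉ˢ B
          outside⁻ z∈ = ∈-locus⁻ (ℓ , ℓ≢0) (proj₁ z∈both) , x∈∁p⇒x∉p (proj₂ z∈both)
            where z∈both = x∈p∩q⁻ on (∁ B) (∈-members⁻ {p = on ∩ ∁ B} z∈)

          outside⇒≢∞ : ∀ {z} → z ∈ outside → z ≢ ∞
          outside⇒≢∞ z∈ z≡∞ = proj₂ (outside⁻ z∈) (subst (_∈ˢ B) (sym z≡∞) ∞∈B)

          -- The lines m + t n meet ℓ once in each point except ∞. As ∞ is in B, every point of ℓ
          -- outside B has a parameter; t = 0 is the given line m through y.
          module Gap {n : Vec Carrier 3} {u : Point} (n≢0 : n ≢ 𝟎) (n∞≡0 : n at ∞ ≡ 0#)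
                     (ℓu≢0 : ℓ at u ≢ 0#) (nu≡0 : n at u ≡ 0#) where

            open Pencil ℓ m n ∞ ℓ≢0 (separatedʳ n≢0 ℓ≢0 nu≡0 ℓu≢0) ℓ∞≡0 n∞≡0 m∞≢0

            family : Carrier → List Carrier
            family t = map (λ v → coordinate m v + t * coordinate n v) us

            at-0 : ∀ v → coordinate m v ≡ coordinate m v + 0# * coordinate n v
            at-0 v = sym (trans (cong (coordinate m v +_) (zeroˡ _)) (+-identityʳ _))

            family≡slopes : ∀ t → family t ≡ slopes (member t)
            family≡slopes t = map-cong (λ v → sym (trans
              (cong (_* inv (ℓ at v)) (at-add-multiple m t n v))
              (S.solve 4 (λ a t b i → (a :+ t :* b) :* i := a :* i :+ t :* (b :* i)) refl
                (m at v) t (n at v) (inv (ℓ at v))))) us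

            τ-unique : Unique (map τ outside)
            τ-unique = unique-map-on τ (members-unique (on ∩ ∁ B)) λ z∈ w∈ →
              τ-injective (proj₁ (outside⁻ z∈)) (outside⇒≢∞ z∈)
                (proj₁ (outside⁻ w∈)) (outside⇒≢∞ w∈)

            -- For z ∈ ℓ outside B the coordinates of U in the pencil of z run over the field.
            e-family-τ : ∀ j {z} → z ∈ outside → e (family (τ z)) j ≡ e elements j
            e-family-τ j {z} z∈ = trans (cong (λ cs → e cs j) (family≡slopes (τ z)))
              (sym (mult-↭ 1ˢ (covering⇒↭ (slopes (member (τ z)))
                (slopes-covering (member-independent (τ z))
                  (member-τ (n≢0-off-∞ (proj₁ (outside⁻ z∈)) (outside⇒≢∞ z∈)))
                  (proj₁ (outside⁻ z∈)) (proj₂ (outside⁻ z∈)))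
                (length-slopes (member (τ z)))) j))

            e-family : ∀ j {t} → t ∈ map τ outside → e (family t) j ≡ e elements j
            e-family j t∈ = let z , z∈ , t≡τz = ∈-map⁻ τ t∈ in
              trans (cong (λ t → e (family t) j) t≡τz) (e-family-τ j z∈)

            -- The r parameters of the points outside B outnumber the degree j, so the known value
            -- extends to t = 0.
            e-slopes : ∀ j → 1 ≤ j → j < r → e (slopes m) j ≡ 0#
            e-slopes j 1≤j j<r = begin
              e (slopes m) j          ≡⟨ cong (λ cs → e cs j) (map-cong at-0 us) ⟩
              e (family 0#) j         ≡⟨ e-vanish j (coordinate m) (coordinate n) us
                (e elements j) τ-unique (subst (j <_) (sym (length-map τ outside)) j<r)
                (e-family j) 0# ⟩
              e elements j            ≡⟨ e-elements j 1≤j (ℕ.≤-<-trans j<r r<q) ⟩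
              0#                      ∎
              where open ≡-Reasoning

          gap : ∀ j → 1 ≤ j → j < r → e (slopes m) j ≡ 0#
          gap = let u , u∈ = some-u
                    n , n≢0 , n∞≡0 , nu≡0 = line-through {∞} {u} λ ∞≡u →
                      ∈us⇒off u∈ (subst (λ i → ℓ at i ≡ 0#) ∞≡u ℓ∞≡0)
                in Gap.e-slopes n≢0 n∞≡0 (∈us⇒off u∈) nu≡0

          zeros-secant : p ∣ zeros (slopes m)
          zeros-secant = [ ι≡0⇒∣ p-prime ιp≡0 _ ,
              (λ covering → contradiction (covering⇒inessential covering) (essential y∈B)) ]′
            (lacunary (length-slopes m) r (ℕ.<⇒≤ r<q) (complement-large {q} {r} {k} q+1≡r+k 2k<q+3) gap)

        zeros-at-blocking-point : p ∣ zeros (slopes m)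
        zeros-at-blocking-point with any? (λ z → ¬? (z Fin.≟ y)) (members (on ∩ B))
        ... | yes some
          with ∞ , ∞∈ , ∞≢y ← find some
          with ∞∈on , ∞∈B ← x∈p∩q⁻ on B (∈-members⁻ {p = on ∩ B} ∞∈) =
          zeros-secant (∈-locus⁻ (ℓ , ℓ≢0) ∞∈on) ∞∈B ∞≢y
        ... | no none = zeros-tangent λ z ℓz≡0 z∈B → decidable-stable (z Fin.≟ y) λ z≢y →
          none (lose (∈-members⁺ {p = on ∩ B}
            (x∈p∩q⁺ {p = on} {q = B} (∈-locus⁺ (ℓ , ℓ≢0) ℓz≡0 , z∈B))) z≢y)

      -- If the point y of M on ℓ is in B, it accounts for the 1 and U for the multiple of p;
      -- otherwise M has exactly one point in U and s = 0. Divisibility in ℕ carries the result from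
      -- the field of order q, where it is proved, to the field of order p of the code.
      ∣M∩B∣≡1+multiple : ∃ λ s → ∣ locus M ∩ B ∣ ≡ s ℕ.+ 1 × p ∣ s
      ∣M∩B∣≡1+multiple
        with y , my≡0 , ℓy≡0 ← common-point m ℓ m×ℓ≢0
        with y ∈? B
      ... | yes y∈B = zeros (slopes m) , trans (∣p∩q∣-split (locus M) B on)
        (cong₂ ℕ._+_ (sym (zeros-slopes M)) (∣p∣≡1
          (x∈p∩q⁺ (x∈p∩q⁺ {p = locus M} {q = on}
            (∈-locus⁺ M my≡0 , ∈-locus⁺ (ℓ , ℓ≢0) ℓy≡0) , y∈B)) only)) ,
        zeros-at-blocking-point my≡0 ℓy≡0 y∈B
        where
        only : ∀ {z} → z ∈ˢ (locus M ∩ on) ∩ B → z ≡ y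
        only z∈
          with z∈M∩on , _ ← x∈p∩q⁻ (locus M ∩ on) B z∈
          with z∈M , z∈on ← x∈p∩q⁻ (locus M) on z∈M∩on =
          common-point-unique m ℓ m×ℓ≢0 (∈-locus⁻ M z∈M) (∈-locus⁻ (ℓ , ℓ≢0) z∈on) my≡0 ℓy≡0
      ... | no y∉B = 0 , trans (∣p∩q∣-split (locus M) B on) (trans
        (cong₂ ℕ._+_ (trans (sym (zeros-slopes M))
          (zeros-unique (slopes-unique covering) (covering 0#))) (∣p∣≡0 none)) refl) , p ∣0
        where
        covering : ∀ x → x ∈ slopes m
        covering = slopes-covering m×ℓ≢0 my≡0 ℓy≡0 y∉B
        none : ∀ {z} → z ∉ˢ (locus M ∩ on) ∩ B
        none z∈
          with z∈M∩on , z∈B ← x∈p∩q⁻ (locus M ∩ on) B z∈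
          with z∈M , z∈on ← x∈p∩q⁻ (locus M) on z∈M∩on =
          y∉B (subst (_∈ˢ B) (common-point-unique m ℓ m×ℓ≢0
            (∈-locus⁻ M z∈M) (∈-locus⁻ (ℓ , ℓ≢0) z∈on) my≡0 ℓy≡0) z∈B)

-- Sums and supports of incidence vectors.

module Indicators {p : ℕ} (K : FiniteField p) where
  open FiniteField K
  open FieldProperties K
  open SemiringSum (CommutativeSemiring.semiring commutativeSemiring) public
    using (sum-cong-≗; sum-replicate-zero; ∑-distrib-+; ∑-comm; *-distribˡ-sum; *-distribʳ-sum)

  indicator : ∀ {n} → Subset n → Fin n → Carrier
  indicator S i = if lookup S i then 1# else 0#

  indicator-∈ : ∀ {n} {S : Subset n} {i} → i ∈ˢ S → indicator S i ≡ 1#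
  indicator-∈ i∈S = cong (if_then 1# else 0#) (Vec.[]=⇒lookup i∈S)

  indicator-∉ : ∀ {n} {S : Subset n} {i} → ¬ i ∈ˢ S → indicator S i ≡ 0#
  indicator-∉ {S = S} {i} i∉S with lookup S i in eq
  ... | true  = contradiction (Vec.lookup⇒[]= i S eq) i∉S
  ... | false = refl

  sum-indicator : ∀ {n} (S : Subset n) → sum (indicator S) ≡ ι ∣ S ∣
  sum-indicator []          = refl
  sum-indicator (true  ∷ S) = cong (1# +_) (sum-indicator S)
  sum-indicator (false ∷ S) = trans (+-identityˡ _) (sum-indicator S)

  sum-indicator-* : ∀ {n} (S T : Subset n) →
                    sum (λ i → indicator S i * indicator T i) ≡ ι ∣ T ∩ S ∣
  sum-indicator-* []          []          = refl
  sum-indicator-* (true  ∷ S) (true  ∷ T) = cong₂ _+_ (*-identityˡ 1#) (sum-indicator-* S T)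
  sum-indicator-* (true  ∷ S) (false ∷ T) =
    trans (cong₂ _+_ (zeroʳ 1#) (sum-indicator-* S T)) (+-identityˡ _)
  sum-indicator-* (false ∷ S) (true  ∷ T) =
    trans (cong₂ _+_ (zeroˡ 1#) (sum-indicator-* S T)) (+-identityˡ _)
  sum-indicator-* (false ∷ S) (false ∷ T) =
    trans (cong₂ _+_ (zeroˡ 0#) (sum-indicator-* S T)) (+-identityˡ _)

  sum-const-1 : ∀ n → sum {n} (λ _ → 1#) ≡ ι n
  sum-const-1 zero    = refl
  sum-const-1 (suc n) = cong (1# +_) (sum-const-1 n)

  sum-zero : ∀ {n} {f : Fin n → Carrier} → (∀ i → f i ≡ 0#) → sum f ≡ 0#
  sum-zero {n} f≡0 = trans (sum-cong-≗ f≡0) (sum-replicate-zero n)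

  sum-single : ∀ {n} {f : Fin n → Carrier} j → f j ≡ 1# → (∀ i → i ≢ j → f i ≡ 0#) →
               sum f ≡ 1#
  sum-single zero    fj≡1 rest =
    trans (cong₂ _+_ fj≡1 (sum-zero λ i → rest (suc i) λ ())) (+-identityʳ 1#)
  sum-single (suc j) fj≡1 rest = trans (cong₂ _+_ (rest zero λ ())
    (sum-single j fj≡1 λ i i≢j → rest (suc i) (i≢j ∘ Fin.suc-injective))) (+-identityˡ 1#)

  support : ∀ {n} → (Fin n → Carrier) → Subset n
  support f = Vec.tabulate λ i → not (does (f i ≟ᶠ 0#))

  -- The entries 1 - 0 and 0 - 1 are nonzero in every characteristic, so the support is the
  -- symmetric difference of S and T.
  ∣support∣ : ∀ {n} (S T : Subset n) →
    ∣ support (λ i → indicator S i - indicator T i) ∣ ℕ.+ (∣ T ∩ S ∣ ℕ.+ ∣ T ∩ S ∣)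
      ≡ ∣ S ∣ ℕ.+ ∣ T ∣
  ∣support∣ []      []      = refl
  ∣support∣ (x ∷ S) (y ∷ T) = step x y
    where
    rest : Subset _
    rest = support (λ i → indicator S i - indicator T i)
    entry : Bool → Bool → Carrier
    entry x y = (if x then 1# else 0#) - (if y then 1# else 0#)
    outside : ∀ x y → entry x y ≡ 0# → ∣ not (does (entry x y ≟ᶠ 0#)) ∷ rest ∣ ≡ ∣ rest ∣
    outside x y eq = cong (λ b → ∣ not b ∷ rest ∣) (dec-true (entry x y ≟ᶠ 0#) eq)
    inside : ∀ x y → entry x y ≢ 0# → ∣ not (does (entry x y ≟ᶠ 0#)) ∷ rest ∣ ≡ suc ∣ rest ∣
    inside x y ne = cong (λ b → ∣ not b ∷ rest ∣) (dec-false (entry x y ≟ᶠ 0#) ne)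
    1-0≢0 : entry true false ≢ 0#
    1-0≢0 eq = 1≢0 (+-cancelʳ (- 0#) (trans eq (sym (-‿inverseʳ 0#))))
    0-1≢0 : entry false true ≢ 0#
    0-1≢0 eq = 0≢1 (+-cancelʳ (- 1#) (trans eq (sym (-‿inverseʳ 1#))))
    step : ∀ x y → ∣ not (does (entry x y ≟ᶠ 0#)) ∷ rest ∣
             ℕ.+ (∣ (y ∷ T) ∩ (x ∷ S) ∣ ℕ.+ ∣ (y ∷ T) ∩ (x ∷ S) ∣) ≡ ∣ x ∷ S ∣ ℕ.+ ∣ y ∷ T ∣
    step false false = trans (cong (ℕ._+ _) (outside false false (-‿inverseʳ 0#))) (∣support∣ S T)
    step true  false = trans (cong (ℕ._+ _) (inside true false 1-0≢0)) (cong suc (∣support∣ S T))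
    step false true  = trans (cong (ℕ._+ _) (inside false true 0-1≢0))
      (trans (cong suc (∣support∣ S T)) (sym (ℕ.+-suc ∣ S ∣ ∣ T ∣)))
    step true  true  = trans (cong (ℕ._+ _) (outside true true (-‿inverseʳ 1#)))
      (trans (solve 2 (λ r i → r :+′ ((con′ 1 :+′ i) :+′ (con′ 1 :+′ i))
          :=′ con′ 2 :+′ (r :+′ (i :+′ i))) refl ∣ rest ∣ ∣ T ∩ S ∣)
        (trans (cong (2 ℕ.+_) (∣support∣ S T)) (cong suc (sym (ℕ.+-suc ∣ S ∣ ∣ T ∣)))))
      where open +-*-Solver using (solve) renaming (_:+_ to _:+′_; con to con′; _:=_ to _:=′_)

-- Counting along pencils and orthogonality to the code.

module Orthogonality {p q : ℕ} (K : FiniteField p) (F : FiniteField q) where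
  open FiniteField K
  open FieldProperties K
  open Indicators K
  open ProjectivePlane F using (PointSet; Line; pointCount)
  open Geometry F
  open Lines F using (module Pencil)
  open LineCode K F
  open S using (_:*_; _:=_)
  private
    module F  = FiniteField F
    module FP = FieldProperties F
    scalar : Fin q → F.Carrier
    scalar = Inverse.from F.enumeration

  indicator-locus-1 : (M : Line) → ∀ {i} → proj₁ M at i ≡ F.0# → indicator (locus M) i ≡ 1#
  indicator-locus-1 M Mi≡0 = indicator-∈ {S = locus M} (∈-locus⁺ M Mi≡0)

  indicator-locus-0 : (M : Line) → ∀ {i} → proj₁ M at i ≢ F.0# → indicator (locus M) i ≡ 0#
  indicator-locus-0 M Mi≢0 = indicator-∉ {S = locus M} (Mi≢0 ∘ ∈-locus⁻ M)

  -- Through every point passes exactly one line of a pencil, or all q + 1 of them.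
  sum-pencil : ι q ≡ 0# → ∀ m (N : Line) (family : ∀ t → add-multiple m t (proj₁ N) ≢ 𝟎) i →
    sum (λ j → indicator (locus (add-multiple m (scalar j) (proj₁ N) , family (scalar j))) i)
      + indicator (locus N) i ≡ 1#
  sum-pencil ιq≡0 m N@(n , _) family i = cases (n at i F.≟ᶠ F.0#) (m at i F.≟ᶠ F.0#)
    where
    M : Fin q → Line
    M j = add-multiple m (scalar j) n , family (scalar j)
    M-at : ∀ j → proj₁ (M j) at i ≡ m at i F.+ scalar j F.* n at i
    M-at j = at-add-multiple m (scalar j) n i
    cases : Dec (n at i ≡ F.0#) → Dec (m at i ≡ F.0#) →
            sum (λ j → indicator (locus (M j)) i) + indicator (locus N) i ≡ 1#
    cases (yes ni≡0) m? = trans (cong₂ _+_ (inner m?) (indicator-locus-1 N ni≡0))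
      (+-identityˡ 1#)
      where
      Mi≡mi : ∀ j → proj₁ (M j) at i ≡ m at i
      Mi≡mi j = trans (M-at j) (trans (cong (λ x → m at i F.+ scalar j F.* x) ni≡0)
        (trans (cong (m at i F.+_) (F.zeroʳ (scalar j))) (F.+-identityʳ (m at i))))
      inner : Dec (m at i ≡ F.0#) → sum (λ j → indicator (locus (M j)) i) ≡ 0#
      -- At the base point all q members contribute, in total `ι q` = 0; the 1 comes from N.
      inner (yes mi≡0) = trans (sum-cong-≗ λ j → indicator-locus-1 (M j) (trans (Mi≡mi j) mi≡0))
        (trans (sum-const-1 q) ιq≡0)
      inner (no mi≢0) = sum-zero λ j →
        indicator-locus-0 (M j) (mi≢0 ∘ trans (sym (Mi≡mi j)))
    cases (no ni≢0) _ = trans (cong₂ _+_ inner (indicator-locus-0 N ni≢0)) (+-identityʳ 1#)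
      where
      -- The only member through i has the parameter - m(i) / n(i).
      t : F.Carrier
      t = FP.ν F.* (m at i F.* FP.inv (n at i))
      j₀ : Fin q
      j₀ = Inverse.to F.enumeration t
      mi+tni≡0 : m at i F.+ t F.* n at i ≡ F.0#
      mi+tni≡0 = trans (FP.S.solve 4 (λ x y i ν →
          x FP.S.:+ ν FP.S.:* (x FP.S.:* i) FP.S.:* y
            FP.S.:= x FP.S.:+ ν FP.S.:* (x FP.S.:* (y FP.S.:* i))) refl
          (m at i) (n at i) (FP.inv (n at i)) FP.ν)
        (trans (cong (λ w → m at i F.+ FP.ν F.* (m at i F.* w)) (FP.inv-inverse (n at i) ni≢0))
          (trans (cong (λ w → m at i F.+ FP.ν F.* w) (F.*-identityʳ (m at i))) (x+νx≡0 (m at i))))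
      inner : sum (λ j → indicator (locus (M j)) i) ≡ 1#
      inner = sum-single j₀
        (indicator-locus-1 (M j₀) (trans (M-at j₀)
          (trans (cong (λ s → m at i F.+ s F.* n at i) (Inverse.strictlyInverseʳ F.enumeration t))
            mi+tni≡0)))
        λ j j≢j₀ → indicator-locus-0 (M j) λ Mi≡0 → j≢j₀ (sym (trans
          (cong (Inverse.to F.enumeration) (FP.*-cancelˡ (n at i) ni≢0 (trans (F.*-comm _ t)
            (trans (FP.+-cancelˡ (m at i) (trans mi+tni≡0 (trans (sym Mi≡0) (M-at j))))
              (F.*-comm (scalar j) _)))))
          (Inverse.strictlyInverseˡ F.enumeration j)))

  -- Double counting: modulo p the q + 1 lines of the pencil cover each point once, and their
  -- intersections with S contribute q + 1, which is 1.
  ι∣S∣≡1-by-pencil : ι q ≡ 0# → ∀ m (N : Line)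
    (family : ∀ t → add-multiple m t (proj₁ N) ≢ 𝟎) (S : PointSet) →
    (∀ t → ι ∣ locus (add-multiple m t (proj₁ N) , family t) ∩ S ∣ ≡ 1#) →
    ι ∣ locus N ∩ S ∣ ≡ 1# → ι ∣ S ∣ ≡ 1#
  ι∣S∣≡1-by-pencil ιq≡0 m N family S members≡1 N≡1 = begin
    ι ∣ S ∣
      ≡⟨ sum-indicator S ⟨
    sum s
      ≡⟨ sum-cong-≗ (λ i → trans (cong (_+ s i * indicator (locus N) i)
           (sym (*-distribˡ-sum (s i) (λ j → indicator (locus (M j)) i))))
           (trans (sym (distribˡ (s i) _ _))
             (trans (cong (s i *_) (sum-pencil ιq≡0 m N family i)) (*-identityʳ (s i))))) ⟨
    sum (λ i → sum (λ j → s i * indicator (locus (M j)) i) + s i * indicator (locus N) i)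
      ≡⟨ ∑-distrib-+ (λ i → sum λ j → s i * indicator (locus (M j)) i)
           (λ i → s i * indicator (locus N) i) ⟩
    sum (λ i → sum λ j → s i * indicator (locus (M j)) i) + sum (λ i → s i * indicator (locus N) i)
      ≡⟨ cong (_+ sum (λ i → s i * indicator (locus N) i))
           (∑-comm (λ j i → s i * indicator (locus (M j)) i)) ⟨
    sum (λ j → sum λ i → s i * indicator (locus (M j)) i) + sum (λ i → s i * indicator (locus N) i)
      ≡⟨ cong₂ _+_ (sum-cong-≗ λ j → trans (sum-indicator-* S (locus (M j))) (members≡1 (scalar j)))
           (trans (sum-indicator-* S (locus N)) N≡1) ⟩
    sum {q} (λ _ → 1#) + 1#
      ≡⟨ cong (_+ 1#) (trans (sum-const-1 q) ιq≡0) ⟩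
    0# + 1#
      ≡⟨ +-identityˡ 1# ⟩
    1# ∎
    where
    open ≡-Reasoning
    s : Fin pointCount → Carrier
    s = indicator S
    M : Fin q → Line
    M j = add-multiple m (scalar j) (proj₁ N) , family (scalar j)

  orthogonal-to-lines⇒∈C⊥ : ∀ v → (∀ M → v · incidenceVector (locus M) ≡ 0#) → v ∈C⊥
  orthogonal-to-lines⇒∈C⊥ v orthogonal w (n , a , lines , w≡) = begin
    sum (λ i → v i * w i)
      ≡⟨ sum-cong-≗ (λ i → trans (cong (v i *_) (w≡ i))
           (*-distribˡ-sum (v i) (λ j → a j * χ j i))) ⟩
    sum (λ i → sum λ j → v i * (a j * χ j i))
      ≡⟨ ∑-comm (λ i j → v i * (a j * χ j i)) ⟩
    sum (λ j → sum λ i → v i * (a j * χ j i))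
      ≡⟨ sum-zero (λ j → trans (sum-cong-≗ λ i → S.solve 3 (λ x y z →
             x :* (y :* z) := y :* (x :* z)) refl (v i) (a j) (χ j i))
           (trans (sym (*-distribˡ-sum (a j) (λ i → v i * χ j i)))
             (trans (cong (a j *_) (orthogonal′ j)) (zeroʳ (a j))))) ⟩
    0# ∎
    where
    open ≡-Reasoning
    χ : Fin n → Word
    χ j = incidenceVector (ProjectivePlane.pointsOn F (lines j))
    orthogonal′ : ∀ j → v · χ j ≡ 0#
    orthogonal′ j = subst (λ f → v · incidenceVector (f (lines j)) ≡ 0#) locus≡pointsOn
      (orthogonal (lines j))

  ⊖-· : ∀ S T U → (incidenceVector S ⊖ incidenceVector T) · incidenceVector U
                    + ι ∣ U ∩ T ∣ ≡ ι ∣ U ∩ S ∣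
  ⊖-· S T U = begin
    sum (λ i → (s i - t i) * u i) + ι ∣ U ∩ T ∣
      ≡⟨ cong (sum (λ i → (s i - t i) * u i) +_) (sum-indicator-* T U) ⟨
    sum (λ i → (s i - t i) * u i) + sum (λ i → t i * u i)
      ≡⟨ ∑-distrib-+ (λ i → (s i - t i) * u i) (λ i → t i * u i) ⟨
    sum (λ i → (s i - t i) * u i + t i * u i)
      ≡⟨ sum-cong-≗ (λ i → trans (sym (distribʳ (u i) (s i - t i) (t i))) (cong (_* u i)
           (trans (+-assoc (s i) (- t i) (t i))
             (trans (cong (s i +_) (-‿inverseˡ (t i))) (+-identityʳ (s i)))))) ⟩
    sum (λ i → s i * u i)
      ≡⟨ sum-indicator-* S U ⟩
    ι ∣ U ∩ S ∣ ∎
    where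
    open ≡-Reasoning
    s = indicator S
    t = indicator T
    u = indicator U

-- The codeword and its weight.

open import Data.Fin.Subset using (_-_)
open import Data.Nat.Base using (_+_; _*_; _∸_; _^_)

module SecantCodeword (p h k : ℕ) (p-prime : Prime p)
                      (Fp : FiniteField p) (Fq : FiniteField (p ^ h)) where
  open ProjectivePlane Fq

  module _ (B : PointSet) (minimal : IsMinimalBlockingSet B)
           (∣B∣≡q+k : ∣ B ∣ ≡ p ^ h + k) (2k<q+3 : 2 * k < p ^ h + 3)
           (L : Line) (∣L∩B∣≡k : ∣ pointsOn L ∩ B ∣ ≡ k) where

    private
      q : ℕ
      q = p ^ h
      module K  = FiniteField Fp
      module KP = FieldProperties Fp
      module FP = FieldProperties Fq
      module F  = FiniteField Fq
    open Geometry Fq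
    open Lines Fq
    open Orthogonality Fp Fq
    open LineCode Fp Fq
    open Indicators Fp using (∣support∣)

    -- For h = 0 the given field would have one element, and `ι-order` would yield 1 = 0. For larger
    -- h the factor p is zero in the field of order p.
    ι-power : ∀ h → FiniteField (p ^ h) → KP.ι (p ^ h) ≡ K.0#
    ι-power zero    F = contradiction
      (trans (sym (FiniteField.+-identityʳ F _)) (FieldProperties.ι-order F)) (FieldProperties.1≢0 F)
    ι-power (suc h) F = trans (KP.ι-* p (p ^ h))
      (trans (cong (K._* KP.ι (p ^ h)) KP.ι-order) (K.zeroˡ _))

    ιq≡0 : KP.ι q ≡ K.0#
    ιq≡0 = ι-power h Fq

    ℓ : Vec F.Carrier 3
    ℓ = proj₁ L

    ℓ≢0 : ℓ ≢ 𝟎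
    ℓ≢0 = proj₂ L

    ∣ℓ∩B∣≡k : ∣ locus L ∩ B ∣ ≡ k
    ∣ℓ∩B∣≡k = trans (cong (λ f → ∣ f L ∩ B ∣) locus≡pointsOn) ∣L∩B∣≡k

    blocks : ∀ m → m ≢ 𝟎 → ∃ λ b → m at b ≡ F.0# × b ∈ˢ B
    blocks m m≢0 = proj₁ blocked , ∈-locus⁻ (m , m≢0) (subst (λ f → proj₁ blocked ∈ˢ f (m , m≢0))
      (sym locus≡pointsOn) (proj₁ both)) , proj₂ both
      where
      blocked = proj₁ minimal (m , m≢0)
      both = x∈p∩q⁻ (pointsOn (m , m≢0)) B (proj₂ blocked)

    essential : ∀ {y} → y ∈ˢ B → ¬ (∀ m → m ≢ 𝟎 → ∃ λ b → m at b ≡ F.0# × b ∈ˢ B × b ≢ y)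
    essential {y} y∈B blocks′ = proj₂ minimal (B - y) (x∈p⇒p-x⊂p {p = B} y∈B) λ M →
      let b , Mb≡0 , b∈B , b≢y = blocks′ (proj₁ M) (proj₂ M)
      in b , x∈p∩q⁺ {p = pointsOn M} {q = B - y}
        (subst (λ f → b ∈ˢ f M) locus≡pointsOn (∈-locus⁺ M Mb≡0) ,
         x∈p∧x≢y⇒x∈p-y {p = B} b∈B b≢y)

    ιp≡0 : FP.ι p ≡ F.0#
    ιp≡0 = FP.ι-^ p h FP.ι-order

    private
      module Sec = Secant Fq

    ι-1 : ∀ {n} → n ≡ 1 → KP.ι n ≡ K.1#
    ι-1 refl = K.+-identityʳ K.1#

    ι∣M∩B∣≡1 : (M : Line) → cross (proj₁ M) ℓ ≢ 𝟎 → KP.ι ∣ locus M ∩ B ∣ ≡ K.1#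
    ι∣M∩B∣≡1 M M×ℓ≢0 = ι-multiple+1 (Sec.∣M∩B∣≡1+multiple p k p-prime ιp≡0 B blocks essential
      ∣B∣≡q+k 2k<q+3 ℓ ℓ≢0 ∣ℓ∩B∣≡k M M×ℓ≢0)
      where
      ι-multiple+1 : ∀ {n} → (∃ λ s → n ≡ s + 1 × p ∣ s) → KP.ι n ≡ K.1#
      ι-multiple+1 (_ , refl , divides c refl) = trans (KP.ι-+ (c * p) 1)
        (trans (cong₂ K._+_ (trans (KP.ι-* c p) (trans (cong (KP.ι c K.*_) KP.ι-order) (K.zeroʳ _)))
          (ι-1 refl)) (K.+-identityˡ K.1#))

    ∞ u : Point
    ∞ = proj₁ (blocks ℓ ℓ≢0)
    u = proj₁ (Sec.some-u p k p-prime ιp≡0 B blocks essential ∣B∣≡q+k 2k<q+3 ℓ ℓ≢0 ∣ℓ∩B∣≡k)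

    ℓ∞≡0 : ℓ at ∞ ≡ F.0#
    ℓ∞≡0 = proj₁ (proj₂ (blocks ℓ ℓ≢0))

    ℓu≢0 : ℓ at u ≢ F.0#
    ℓu≢0 = Sec.∈us⇒off p k p-prime ιp≡0 B blocks essential ∣B∣≡q+k 2k<q+3 ℓ ℓ≢0 ∣ℓ∩B∣≡k
      (proj₂ (Sec.some-u p k p-prime ιp≡0 B blocks essential ∣B∣≡q+k 2k<q+3 ℓ ℓ≢0 ∣ℓ∩B∣≡k))

    ∣L∣≡q+1 : ∣ locus L ∣ ≡ q + 1
    ∣L∣≡q+1 = ∣line∣≡q+1 L ℓ∞≡0 ℓu≢0

    ι∣L∣≡1 : KP.ι ∣ locus L ∣ ≡ K.1#
    ι∣L∣≡1 = trans (cong KP.ι ∣L∣≡q+1) (trans (KP.ι-+ q 1)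
      (trans (cong₂ K._+_ ιq≡0 (ι-1 refl)) (K.+-identityˡ K.1#)))

    ιk≡1 : KP.ι k ≡ K.1#
    ιk≡1 = begin
      KP.ι k
        ≡⟨ K.+-identityˡ _ ⟨
      K.0# K.+ KP.ι k
        ≡⟨ cong (K._+ KP.ι k) ιq≡0 ⟨
      KP.ι q K.+ KP.ι k
        ≡⟨ trans (cong KP.ι ∣B∣≡q+k) (KP.ι-+ q k) ⟨
      KP.ι ∣ B ∣
        ≡⟨ ι∣S∣≡1-by-pencil ιq≡0 m N family B
             (λ t → ι∣M∩B∣≡1 (P.member t , family t) (P.member-independent t))
             (ι∣M∩B∣≡1 N n×ℓ≢0) ⟩
      K.1# ∎
      where
      open ≡-Reasoning
      -- No line of the pencil is L: n passes through u off L, and every m + t n is nonzero at the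
      -- point ∞ of L.
      joining = line-through {∞} {u} (λ ∞≡u → ℓu≢0 (subst (λ i → ℓ at i ≡ F.0#) ∞≡u ℓ∞≡0))
      n : Vec F.Carrier 3
      n = proj₁ joining
      N : Line
      N = n , proj₁ (proj₂ joining)
      n×ℓ≢0 : cross n ℓ ≢ 𝟎
      n×ℓ≢0 = separatedʳ (proj₂ N) ℓ≢0 (proj₂ (proj₂ (proj₂ joining))) ℓu≢0
      m : Vec F.Carrier 3
      m = proj₁ (nonvanishing-at ∞)
      module P = Pencil ℓ m n ∞ ℓ≢0 n×ℓ≢0 ℓ∞≡0 (proj₁ (proj₂ (proj₂ joining)))
        (proj₂ (nonvanishing-at ∞))
      family : ∀ t → add-multiple m t n ≢ 𝟎
      family t = cross≢0⇒≢0 (P.member t) ℓ (P.member-independent t)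

    v : Word
    v = incidenceVector B ⊖ incidenceVector (locus L)

    -- If M is not L, then M ∩ B and M ∩ L both have size 1 modulo p. If M is L, the sizes are k and
    -- q + 1, which are 1 modulo p as well.
    v-orthogonal : ∀ M → v · incidenceVector (locus M) ≡ K.0#
    v-orthogonal M = KP.+-cancelʳ (KP.ι ∣ locus M ∩ locus L ∣) (trans (⊖-· B (locus L) (locus M))
      (trans (equal (Vec.≡-dec F._≟ᶠ_ (cross (proj₁ M) ℓ) 𝟎)) (sym (K.+-identityˡ _))))
      where
      equal : Dec (cross (proj₁ M) ℓ ≡ 𝟎) →
              KP.ι ∣ locus M ∩ B ∣ ≡ KP.ι ∣ locus M ∩ locus L ∣
      equal (no M×ℓ≢0) = trans (ι∣M∩B∣≡1 M M×ℓ≢0) (sym (ι-1 (∣m∩n∣≡1 M L M×ℓ≢0)))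
      equal (yes M×ℓ≡0) = subst (λ S → KP.ι ∣ S ∩ B ∣ ≡ KP.ι ∣ S ∩ locus L ∣)
        (sym (proportional-locus M L M×ℓ≡0))
        (trans (cong KP.ι ∣ℓ∩B∣≡k) (trans ιk≡1
          (sym (trans (cong (KP.ι ∘ ∣_∣) (∩-idem (locus L))) ι∣L∣≡1))))

    -- `∣support∣` gives weight + 2 k = (q + k) + (q + 1). Hence weight + k = 2 q + 1, so the
    -- truncated subtraction is exact.
    weight-v : weight v ≡ 2 * q + 1 ∸ k
    weight-v = trans (sym (ℕ.m+n∸n≡m (weight v) k)) (cong (_∸ k)
      (ℕ.+-cancelʳ-≡ k (weight v + k) (2 * q + 1) (begin
        weight v + k + k
          ≡⟨ ℕ.+-assoc (weight v) k k ⟩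
        weight v + (k + k)
          ≡⟨ cong (λ i → weight v + (i + i)) ∣ℓ∩B∣≡k ⟨
        weight v + (∣ locus L ∩ B ∣ + ∣ locus L ∩ B ∣)
          ≡⟨ ∣support∣ B (locus L) ⟩
        ∣ B ∣ + ∣ locus L ∣
          ≡⟨ cong₂ _+_ ∣B∣≡q+k ∣L∣≡q+1 ⟩
        q + k + (q + 1)
          ≡⟨ solve 2 (λ q k → q :+ k :+ (q :+ con 1) := con 2 :* q :+ con 1 :+ k) refl q k ⟩
        2 * q + 1 + k ∎)))
      where
      open ≡-Reasoning
      open +-*-Solver using (solve; _:+_; _:*_; con; _:=_)

    codeword : v ∈C⊥ × weight v ≡ 2 * q + 1 ∸ k
    codeword = orthogonal-to-lines⇒∈C⊥ v v-orthogonal , weight-v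

mainTheorem18 : (p h k : ℕ) → Prime p → (Fp : FiniteField p) (Fq : FiniteField (p ^ h)) →
    let q = p ^ h
        open ProjectivePlane Fq
        open LineCode Fp Fq
    in (B : PointSet) → IsMinimalBlockingSet B →
       ∣ B ∣ ≡ q + k → 2 * k < q + 3 →
       (L : Line) → ∣ pointsOn L ∩ B ∣ ≡ k →
       ((incidenceVector B ⊖ incidenceVector (pointsOn L)) ∈C⊥) ×
       weight (incidenceVector B ⊖ incidenceVector (pointsOn L)) ≡ 2 * q + 1 ∸ k
mainTheorem18 p h k p-prime Fp Fq B minimal ∣B∣≡q+k 2k<q+3 L ∣L∩B∣≡k =
  subst (λ f → ((incidenceVector B ⊖ incidenceVector (f L)) ∈C⊥) ×
           weight (incidenceVector B ⊖ incidenceVector (f L)) ≡ 2 * p ^ h + 1 ∸ k)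
    (Geometry.locus≡pointsOn Fq)
    (SecantCodeword.codeword p h k p-prime Fp Fq B minimal ∣B∣≡q+k 2k<q+3 L ∣L∩B∣≡k)
  where open LineCode Fp Fq
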